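{- Let $\Psi_{\mathbf{G}}:\mathbf{G}\to Sym$ be the linear map sending a graph $G$ with vertex set $[n]$ to its chromatic symmetric function $\Psi_{\mathbf{G}}(G)=\sum_f\prod_{v\in[n]}x_{f(v)}$, the sum running over proper colorings $f$ of $G$. Then the linear space $\ker\Psi_{\mathbf{G}}$ is generated (spanned) by the modular relations and the isomorphism relations on graphs, and the image of $\Psi_{\mathbf{G}}$ is $Sym$.
   Context: $\mathbb{K}$ is a field of characteristic zero; $\mathbb{N}=\{1,2,\dots\}$ and $[n]=\{1,\dots,n\}$. $\mathbf{G}=\bigoplus_{n\ge 0}\mathbf{G}_n$, where $\mathbf{G}_n$ is the $\mathbb{K}$-vector space freely generated by the (simple) graphs with vertex set $[n]$. A coloring of $G$ is a function $f:V(G)\to\mathbb{N}$; it is proper if no edge is monochromatic. $Sym$ is the $\mathbb{K}$-algebra of symmetric functions in the commuting variables $x_1,x_2,\dots$. Modular relation on graphs: let $G$ be a graph with vertex set $[n]$ and $e_1,e_2,e_3$ the three edges of a triangle on three distinct vertices of $[n]$ with $e_3\in E(G)$ and $e_1,e_2\notin E(G)$. The corresponding modular relation is the element $G-G\cup\{e_1\}-G\cup\{e_2\}+G\cup\{e_1,e_2\}$ of $\mathbf{G}$, where $G\cup E$ denotes $G$ with the edges in $E$ added. Isomorphism relation on graphs: an element $G_1-G_2$ of $\mathbf{G}$, where $G_1,G_2$ are isomorphic graphs. -}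

module Defs where

open import Algebra.Apartness.Bundles using (HeytingField; HeytingCommutativeRing)
open import Algebra.Bundles using (Ring; CommutativeRing)
open import Algebra.Module.Bundles using (LeftModule)
import Algebra.Definitions.RawMonoid as RawMonoidDefinitions
import Algebra.Module.Morphism.Structures as ModuleMorphisms
import Algebra.Properties.AbelianGroup as AbelianGroupProperties
import Algebra.Properties.Ring as RingProperties
open import Data.Bool.Base using (Bool; true; false; if_then_else_; _∨_; T)
open import Data.Bool.Properties using (T?; ∨-comm)
import Data.Bool.Properties as Bool
open import Data.Empty using (⊥-elim)
open import Data.Fin.Base using (Fin)
open import Data.Fin.Permutation using (Permutation; _⟨$⟩ʳ_)
import Data.Fin.Properties as Fin
open import Data.List.Base using (List; []; _∷_; [_]; _++_; map; filter; length; cartesianProductWith; deduplicate)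
open import Data.List.Properties using (length-map; length-filter; map-id; map-∘; map-cong)
open import Data.List.Membership.Propositional using (_∈_)
open import Data.List.Membership.Propositional.Properties
  using (∈-∃++; ∈-filter⁺; ∈-filter⁻; ∈-map⁺; ∈-map⁻; ∈-deduplicate⁺; ∈-cartesianProductWith⁺)
open import Data.List.Membership.Propositional.Properties.WithK using (unique∧set⇒bag)
open import Data.List.Relation.Binary.BagAndSetEquality using (∼bag⇒↭)
open import Data.List.Relation.Binary.Permutation.Propositional using (_↭_; ↭-refl; ↭-sym; ↭-trans; ↭-prep; ↭-reflexive)
open import Data.List.Relation.Binary.Permutation.Propositional.Properties
  using (↭-length; ¬x∷xs↭[]; ∈-resp-↭; shift; drop-∷)
  renaming (map⁺ to ↭-map⁺)
open import Data.List.Relation.Unary.All using ([])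
open import Data.List.Relation.Unary.Any using (here; there)
open import Data.List.Relation.Unary.Unique.Propositional using (Unique; []; _∷_)
import Data.List.Relation.Unary.Unique.Propositional.Properties as Unique
open import Data.Nat.Base using (ℕ; zero; suc; _≤_; _<_; s≤s; _⊔_)
import Data.Nat.Properties as ℕ
open import Data.List.Relation.Unary.Unique.DecPropositional.Properties ℕ._≟_ using (deduplicate-!)
open import Data.List.Membership.DecPropositional ℕ._≟_ using (_∈?_)
open import Data.Product.Base using (∃; _×_; _,_; proj₁; proj₂; map₁)
open import Data.Vec.Base using (Vec; []; _∷_; lookup; toList)
import Data.Vec.Base as Vec
import Data.Vec.Properties as Vec
open import Function.Base using (_∘_)
open import Function.Bundles using (_↔_; mk⇔; module Inverse; module Injection)
open import Function.Properties.Inverse using (↔-sym; ↔⇒↣)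
open import Level using (Level; 0ℓ) renaming (_⊔_ to _⊔ˡ_)
open import Relation.Binary.Bundles using (DecSetoid)
open import Relation.Binary.Core using (Rel)
open import Relation.Binary.Definitions using (Decidable)
open import Relation.Binary.PropositionalEquality as ≡ using (_≡_; _≢_; refl; cong; cong₂; subst)
import Relation.Binary.Reasoning.Setoid as SetoidReasoning
open import Relation.Nullary using (yes; no; does; ¬_; ¬?; _×-dec_; _→-dec_)
open import Relation.Nullary.Decidable using (map′; ⌊_⌋)
import Relation.Unary as U
open import Relation.Unary using (Pred)

private
  variable
    a b c i p r s ℓ₁ ℓ₂ ℓr ℓs ℓa ℓb : Level

commutativeRing : HeytingField c ℓ₁ ℓ₂ → CommutativeRing c ℓ₁
commutativeRing K = HeytingCommutativeRing.commutativeRing (HeytingField.heytingCommutativeRing K)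

-- x # 0# says exactly that x is invertible.  Classically a Heyting field is
-- just a field with x # y meaning ¬ (x ≈ y), since _#_ is tight.
CharacteristicZero : HeytingField c ℓ₁ ℓ₂ → Set ℓ₂
CharacteristicZero K = ∀ k → (suc k · 1#) # 0#
  where
  open HeytingField K using (_#_; 0#; 1#)
  open RawMonoidDefinitions (CommutativeRing.+-rawMonoid (commutativeRing K)) using () renaming (_×_ to _·_)

module _ {R : Ring r ℓr} where

  data Span (M : LeftModule R a ℓa) (P : Pred (LeftModule.Carrierᴹ M) p)
       : Pred (LeftModule.Carrierᴹ M) (r ⊔ˡ a ⊔ˡ ℓa ⊔ˡ p) where
    gen   : ∀ {x} → P x → Span M P x
    0∈    : Span M P (LeftModule.0ᴹ M)
    +∈    : ∀ {x y} → Span M P x → Span M P y → Span M P (LeftModule._+ᴹ_ M x y)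
    *∈    : ∀ k {x} → Span M P x → Span M P (LeftModule._*ₗ_ M k x)
    resp≈ : ∀ {x y} → LeftModule._≈ᴹ_ M x y → Span M P x → Span M P y

  IsLinear : (M : LeftModule R a ℓa) (N : LeftModule R b ℓb) →
             (LeftModule.Carrierᴹ M → LeftModule.Carrierᴹ N) → Set (r ⊔ˡ a ⊔ˡ ℓa ⊔ˡ ℓb)
  IsLinear M N = IsLeftModuleHomomorphism
    where open ModuleMorphisms.LeftModuleMorphisms (LeftModule.rawLeftModule M) (LeftModule.rawLeftModule N)

  record LinearMap (M : LeftModule R a ℓa) (N : LeftModule R b ℓb)
         : Set (r ⊔ˡ a ⊔ˡ ℓa ⊔ˡ b ⊔ˡ ℓb) where
    field
      to       : LeftModule.Carrierᴹ M → LeftModule.Carrierᴹ N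
      isLinear : IsLinear M N to

  Kernel : {M : LeftModule R a ℓa} {N : LeftModule R b ℓb} →
           LinearMap M N → Pred (LeftModule.Carrierᴹ M) ℓb
  Kernel {N = N} f x = to x ≈ᴹ 0ᴹ
    where
    open LinearMap f
    open LeftModule N

module _ (R : CommutativeRing r ℓr) where

  open CommutativeRing R

  -- The elements of A are determined by their families of coefficients, on
  -- which the operations act pointwise.
  module Pointwise
    {A : Set a} {I : Set i}
    (coeff : A → I → Carrier)
    (_⊕_ : A → A → A) (𝟘 : A) (⊖_ : A → A) (_⊙_ : Carrier → A → A)
    (⊕-coeff : ∀ x y j → coeff (x ⊕ y) j ≈ coeff x j + coeff y j)
    (𝟘-coeff : ∀ j → coeff 𝟘 j ≈ 0#)
    (⊖-coeff : ∀ x j → coeff (⊖ x) j ≈ - coeff x j)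
    (⊙-coeff : ∀ k x j → coeff (k ⊙ x) j ≈ k * coeff x j)
    where

    open SetoidReasoning setoid

    leftModule : LeftModule ring a (i ⊔ˡ ℓr)
    leftModule = record
      { Carrierᴹ = A
      ; _≈ᴹ_ = λ x y → ∀ j → coeff x j ≈ coeff y j
      ; _+ᴹ_ = _⊕_
      ; _*ₗ_ = _⊙_
      ; 0ᴹ = 𝟘
      ; -ᴹ_ = ⊖_
      ; isLeftModule = record
        { isLeftSemimodule = record
          { +ᴹ-isCommutativeMonoid = record
            { isMonoid = record
              { isSemigroup = record
                { isMagma = record
                  { isEquivalence = record
                    { refl = λ j → CommutativeRing.refl R
                    ; sym = λ x≈y j → sym (x≈y j)
                    ; trans = λ x≈y y≈z j → trans (x≈y j) (y≈z j)
                    }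
                  ; ∙-cong = λ {x} {y} {u} {v} x≈y u≈v j → begin
                      coeff (x ⊕ u) j       ≈⟨ ⊕-coeff x u j ⟩
                      coeff x j + coeff u j ≈⟨ +-cong (x≈y j) (u≈v j) ⟩
                      coeff y j + coeff v j ≈⟨ ⊕-coeff y v j ⟨
                      coeff (y ⊕ v) j       ∎
                  }
                ; assoc = λ x y z j → begin
                    coeff ((x ⊕ y) ⊕ z) j                 ≈⟨ ⊕-coeff (x ⊕ y) z j ⟩
                    coeff (x ⊕ y) j + coeff z j           ≈⟨ +-congʳ (⊕-coeff x y j) ⟩
                    (coeff x j + coeff y j) + coeff z j   ≈⟨ +-assoc _ _ _ ⟩
                    coeff x j + (coeff y j + coeff z j)   ≈⟨ +-congˡ (⊕-coeff y z j) ⟨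
                    coeff x j + coeff (y ⊕ z) j           ≈⟨ ⊕-coeff x (y ⊕ z) j ⟨
                    coeff (x ⊕ (y ⊕ z)) j                 ∎
                }
              ; identity =
                  (λ x j → trans (⊕-coeff 𝟘 x j) (trans (+-congʳ (𝟘-coeff j)) (+-identityˡ _)))
                , (λ x j → trans (⊕-coeff x 𝟘 j) (trans (+-congˡ (𝟘-coeff j)) (+-identityʳ _)))
              }
            ; comm = λ x y j → trans (⊕-coeff x y j) (trans (+-comm _ _) (sym (⊕-coeff y x j)))
            }
          ; isPreleftSemimodule = record
            { *ₗ-cong = λ {k} {l} {x} {y} k≈l x≈y j →
                trans (⊙-coeff k x j) (trans (*-cong k≈l (x≈y j)) (sym (⊙-coeff l y j)))
            ; *ₗ-zeroˡ = λ x j → trans (⊙-coeff 0# x j) (trans (zeroˡ _) (sym (𝟘-coeff j)))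
            ; *ₗ-distribʳ = λ x k l j → begin
                coeff ((k + l) ⊙ x) j               ≈⟨ ⊙-coeff (k + l) x j ⟩
                (k + l) * coeff x j                 ≈⟨ distribʳ _ _ _ ⟩
                k * coeff x j + l * coeff x j       ≈⟨ +-cong (⊙-coeff k x j) (⊙-coeff l x j) ⟨
                coeff (k ⊙ x) j + coeff (l ⊙ x) j   ≈⟨ ⊕-coeff (k ⊙ x) (l ⊙ x) j ⟨
                coeff ((k ⊙ x) ⊕ (l ⊙ x)) j         ∎
            ; *ₗ-identityˡ = λ x j → trans (⊙-coeff 1# x j) (*-identityˡ _)
            ; *ₗ-assoc = λ k l x j → begin
                coeff ((k * l) ⊙ x) j   ≈⟨ ⊙-coeff (k * l) x j ⟩
                (k * l) * coeff x j     ≈⟨ *-assoc _ _ _ ⟩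
                k * (l * coeff x j)     ≈⟨ *-congˡ (⊙-coeff l x j) ⟨
                k * coeff (l ⊙ x) j     ≈⟨ ⊙-coeff k (l ⊙ x) j ⟨
                coeff (k ⊙ (l ⊙ x)) j   ∎
            ; *ₗ-zeroʳ = λ k j → trans (⊙-coeff k 𝟘 j)
                (trans (*-congˡ (𝟘-coeff j)) (trans (zeroʳ k) (sym (𝟘-coeff j))))
            ; *ₗ-distribˡ = λ k x y j → begin
                coeff (k ⊙ (x ⊕ y)) j               ≈⟨ ⊙-coeff k (x ⊕ y) j ⟩
                k * coeff (x ⊕ y) j                 ≈⟨ *-congˡ (⊕-coeff x y j) ⟩
                k * (coeff x j + coeff y j)         ≈⟨ distribˡ _ _ _ ⟩
                k * coeff x j + k * coeff y j       ≈⟨ +-cong (⊙-coeff k x j) (⊙-coeff k y j) ⟨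
                coeff (k ⊙ x) j + coeff (k ⊙ y) j   ≈⟨ ⊕-coeff (k ⊙ x) (k ⊙ y) j ⟨
                coeff ((k ⊙ x) ⊕ (k ⊙ y)) j         ∎
            }
          }
        ; -ᴹ‿cong = λ {x} {y} x≈y j →
            trans (⊖-coeff x j) (trans (-‿cong (x≈y j)) (sym (⊖-coeff y j)))
        ; -ᴹ‿inverse =
            (λ x j → trans (⊕-coeff (⊖ x) x j)
              (trans (+-congʳ (⊖-coeff x j)) (trans (-‿inverseˡ _) (sym (𝟘-coeff j)))))
          , (λ x j → trans (⊕-coeff x (⊖ x) j)
              (trans (+-congˡ (⊖-coeff x j)) (trans (-‿inverseʳ _) (sym (𝟘-coeff j)))))
        }
      }

-- The free module: an element is a finite formal linear combination, and two
-- of them are equal when every generator has the same total coefficient in both.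
module Free (R : CommutativeRing r ℓr) (S : DecSetoid s ℓs) where

  open CommutativeRing R
  open DecSetoid S using (_≟_) renaming (Carrier to Gen; _≈_ to _~_; sym to ~-sym; trans to ~-trans)

  Combination : Set (r ⊔ˡ s)
  Combination = List (Carrier × Gen)

  coeff : Combination → Gen → Carrier
  coeff []            t = 0#
  coeff ((k , u) ∷ z) t = (if does (u ≟ t) then k else 0#) + coeff z t

  _⊙_ : Carrier → Combination → Combination
  k ⊙ z = map (map₁ (k *_)) z

  ⊖_ : Combination → Combination
  ⊖ z = map (map₁ (λ k → - k)) z

  open RingProperties ring using (-0#≈0#; -‿+-comm)
  open SetoidReasoning setoid

  ++-coeff : ∀ x y t → coeff (x ++ y) t ≈ coeff x t + coeff y t
  ++-coeff []            y t = sym (+-identityˡ _)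
  ++-coeff ((k , u) ∷ x) y t = trans (+-congˡ (++-coeff x y t)) (sym (+-assoc _ _ _))

  ⊖-coeff : ∀ x t → coeff (⊖ x) t ≈ - coeff x t
  ⊖-coeff []            t = sym -0#≈0#
  ⊖-coeff ((k , u) ∷ x) t with does (u ≟ t)
  ... | true  = trans (+-congˡ (⊖-coeff x t)) (-‿+-comm _ _)
  ... | false = trans (+-cong (sym -0#≈0#) (⊖-coeff x t)) (-‿+-comm _ _)

  ⊙-coeff : ∀ k x t → coeff (k ⊙ x) t ≈ k * coeff x t
  ⊙-coeff k []            t = sym (zeroʳ k)
  ⊙-coeff k ((l , u) ∷ x) t with does (u ≟ t)
  ... | true  = trans (+-congˡ (⊙-coeff k x t)) (sym (distribˡ _ _ _))
  ... | false = trans (+-cong (sym (zeroʳ k)) (⊙-coeff k x t)) (sym (distribˡ _ _ _))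

  open Pointwise R coeff _++_ [] ⊖_ _⊙_ ++-coeff (λ t → CommutativeRing.refl R) ⊖-coeff ⊙-coeff public
    using (leftModule)

  ⟨_⟩ : Gen → Combination
  ⟨ t ⟩ = [ 1# , t ]

  module Extension
    (N : LeftModule ring b ℓb)
    (f : Gen → LeftModule.Carrierᴹ N)
    (f-cong : ∀ {t u} → t ~ u → LeftModule._≈ᴹ_ N (f t) (f u))
    where

    open LeftModule N

    extend : Combination → Carrierᴹ
    extend []            = 0ᴹ
    extend ((k , t) ∷ z) = k *ₗ f t +ᴹ extend z

    module ≈ᴹ = SetoidReasoning ≈ᴹ-setoid
    open AbelianGroupProperties +ᴹ-abelianGroup
      using (inverseʳ-unique; ⁻¹-∙-comm)
      renaming (ε⁻¹≈ε to -0ᴹ≈0ᴹ; x∙y⁻¹≈ε⇒x≈y to difference-zero)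

    extend-++ : ∀ x y → extend (x ++ y) ≈ᴹ extend x +ᴹ extend y
    extend-++ []            y = ≈ᴹ-sym (+ᴹ-identityˡ _)
    extend-++ ((k , t) ∷ x) y = ≈ᴹ-trans (+ᴹ-congˡ (extend-++ x y)) (≈ᴹ-sym (+ᴹ-assoc _ _ _))

    extend-⊙ : ∀ k x → extend (k ⊙ x) ≈ᴹ k *ₗ extend x
    extend-⊙ k []            = ≈ᴹ-sym (*ₗ-zeroʳ k)
    extend-⊙ k ((l , t) ∷ x) =
      ≈ᴹ-trans (+ᴹ-cong (*ₗ-assoc k l (f t)) (extend-⊙ k x)) (≈ᴹ-sym (*ₗ-distribˡ k _ _))

    -‿*ₗ : ∀ k u → (- k) *ₗ u ≈ᴹ -ᴹ (k *ₗ u)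
    -‿*ₗ k u = inverseʳ-unique (k *ₗ u) ((- k) *ₗ u) (≈ᴹ.begin
      k *ₗ u +ᴹ (- k) *ₗ u  ≈ᴹ.≈⟨ *ₗ-distribʳ u k (- k) ⟨
      (k + - k) *ₗ u        ≈ᴹ.≈⟨ *ₗ-congʳ (-‿inverseʳ k) ⟩
      0# *ₗ u               ≈ᴹ.≈⟨ *ₗ-zeroˡ u ⟩
      0ᴹ                    ≈ᴹ.∎)

    extend-⊖ : ∀ x → extend (⊖ x) ≈ᴹ -ᴹ extend x
    extend-⊖ []            = ≈ᴹ-sym -0ᴹ≈0ᴹ
    extend-⊖ ((k , t) ∷ x) =
      ≈ᴹ-trans (+ᴹ-cong (-‿*ₗ k (f t)) (extend-⊖ x)) (⁻¹-∙-comm _ _)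

    remove : Gen → Combination → Combination
    remove t = filter (λ e → ¬? (proj₂ e ≟ t))

    split : ∀ t z → extend z ≈ᴹ coeff z t *ₗ f t +ᴹ extend (remove t z)
    split t [] = ≈ᴹ-sym (≈ᴹ-trans (+ᴹ-identityʳ _) (*ₗ-zeroˡ (f t)))
    split t ((k , u) ∷ z) with u ≟ t
    ... | yes u~t = ≈ᴹ.begin
      k *ₗ f u +ᴹ extend z                                          ≈ᴹ.≈⟨ +ᴹ-cong (*ₗ-congˡ (f-cong u~t)) (split t z) ⟩
      k *ₗ f t +ᴹ (coeff z t *ₗ f t +ᴹ extend (remove t z))          ≈ᴹ.≈⟨ +ᴹ-assoc _ _ _ ⟨
      (k *ₗ f t +ᴹ coeff z t *ₗ f t) +ᴹ extend (remove t z)          ≈ᴹ.≈⟨ +ᴹ-congʳ (*ₗ-distribʳ (f t) k (coeff z t)) ⟨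
      (k + coeff z t) *ₗ f t +ᴹ extend (remove t z)                  ≈ᴹ.∎
    ... | no  u≁t = ≈ᴹ.begin
      k *ₗ f u +ᴹ extend z                                          ≈ᴹ.≈⟨ +ᴹ-congˡ (split t z) ⟩
      k *ₗ f u +ᴹ (coeff z t *ₗ f t +ᴹ extend (remove t z))          ≈ᴹ.≈⟨ +ᴹ-assoc _ _ _ ⟨
      (k *ₗ f u +ᴹ coeff z t *ₗ f t) +ᴹ extend (remove t z)          ≈ᴹ.≈⟨ +ᴹ-congʳ (+ᴹ-comm _ _) ⟩
      (coeff z t *ₗ f t +ᴹ k *ₗ f u) +ᴹ extend (remove t z)          ≈ᴹ.≈⟨ +ᴹ-assoc _ _ _ ⟩
      coeff z t *ₗ f t +ᴹ (k *ₗ f u +ᴹ extend (remove t z))          ≈ᴹ.≈⟨ +ᴹ-congʳ (*ₗ-congʳ (+-identityˡ _)) ⟨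
      (0# + coeff z t) *ₗ f t +ᴹ (k *ₗ f u +ᴹ extend (remove t z))   ≈ᴹ.∎

    coeff-remove-~ : ∀ t z {u} → t ~ u → coeff (remove t z) u ≈ 0#
    coeff-remove-~ t []            t~u = CommutativeRing.refl R
    coeff-remove-~ t ((k , v) ∷ z) {u} t~u with v ≟ t
    ... | yes _  = coeff-remove-~ t z t~u
    ... | no v≁t with v ≟ u
    ...   | yes v~u = ⊥-elim (v≁t (~-trans v~u (~-sym t~u)))
    ...   | no _    = trans (+-identityˡ _) (coeff-remove-~ t z t~u)

    coeff-remove-≁ : ∀ t z {u} → ¬ (t ~ u) → coeff (remove t z) u ≈ coeff z u
    coeff-remove-≁ t []            t≁u = CommutativeRing.refl R
    coeff-remove-≁ t ((k , v) ∷ z) {u} t≁u with v ≟ t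
    ... | no _    = +-congˡ (coeff-remove-≁ t z t≁u)
    ... | yes v~t with v ≟ u
    ...   | yes v~u = ⊥-elim (t≁u (~-trans (~-sym v~t) v~u))
    ...   | no _    = trans (coeff-remove-≁ t z t≁u) (sym (+-identityˡ _))

    length-remove : ∀ k t z → length (remove t ((k , t) ∷ z)) ≤ length z
    length-remove k t z with t ≟ t
    ... | yes _ = length-filter (λ e → ¬? (proj₂ e ≟ t)) z
    ... | no t≁t = ⊥-elim (t≁t (DecSetoid.refl S))

    extend-zero : ∀ l z → length z ≤ l → (∀ t → coeff z t ≈ 0#) → extend z ≈ᴹ 0ᴹ
    extend-zero l       []              _         z≈0 = ≈ᴹ-refl
    extend-zero (suc l) z@((k , t) ∷ y) (s≤s y≤l) z≈0 = ≈ᴹ.begin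
      extend z                                 ≈ᴹ.≈⟨ split t z ⟩
      coeff z t *ₗ f t +ᴹ extend (remove t z)   ≈ᴹ.≈⟨ +ᴹ-cong (≈ᴹ-trans (*ₗ-congʳ (z≈0 t)) (*ₗ-zeroˡ _))
                                                   (extend-zero l (remove t z) (ℕ.≤-trans (length-remove k t y) y≤l) rest≈0) ⟩
      0ᴹ +ᴹ 0ᴹ                                  ≈ᴹ.≈⟨ +ᴹ-identityˡ 0ᴹ ⟩
      0ᴹ                                       ≈ᴹ.∎
      where
      rest≈0 : ∀ u → coeff (remove t z) u ≈ 0#
      rest≈0 u with t ≟ u
      ... | yes t~u = coeff-remove-~ t z t~u
      ... | no  t≁u = trans (coeff-remove-≁ t z t≁u) (z≈0 u)

    extend-cong : ∀ {x y} → (∀ t → coeff x t ≈ coeff y t) → extend x ≈ᴹ extend y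
    extend-cong {x} {y} x≈y = difference-zero _ _ (≈ᴹ.begin
      extend x +ᴹ -ᴹ extend y     ≈ᴹ.≈⟨ +ᴹ-congˡ (extend-⊖ y) ⟨
      extend x +ᴹ extend (⊖ y)    ≈ᴹ.≈⟨ extend-++ x (⊖ y) ⟨
      extend (x ++ (⊖ y))         ≈ᴹ.≈⟨ extend-zero _ (x ++ (⊖ y)) ℕ.≤-refl coeffs ⟩
      0ᴹ                          ≈ᴹ.∎)
      where
      coeffs : ∀ t → coeff (x ++ (⊖ y)) t ≈ 0#
      coeffs t = begin
        coeff (x ++ (⊖ y)) t       ≈⟨ ++-coeff x (⊖ y) t ⟩
        coeff x t + coeff (⊖ y) t  ≈⟨ +-cong (x≈y t) (⊖-coeff y t) ⟩
        coeff y t + - coeff y t    ≈⟨ -‿inverseʳ _ ⟩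
        0#                         ∎

    linearMap : LinearMap leftModule N
    linearMap = record
      { to = extend
      ; isLinear = record
        { +ᴹ-isGroupHomomorphism = record
          { isMonoidHomomorphism = record
            { isMagmaHomomorphism = record
              { isRelHomomorphism = record { cong = λ {x} {y} → extend-cong {x} {y} }
              ; homo = extend-++
              }
            ; ε-homo = ≈ᴹ-refl
            }
          ; ⁻¹-homo = extend-⊖
          }
        ; *ₗ-homo = extend-⊙
        }
      }

record Graph (n : ℕ) : Set where
  field
    adj       : Fin n → Fin n → Bool
    symmetric : ∀ u v → adj u v ≡ adj v u
    loopless  : ∀ v → adj v v ≡ false

open Graph

SomeGraph : Set
SomeGraph = ∃ Graph

data _≐_ : Rel SomeGraph 0ℓ where
  same : ∀ {n} {G H : Graph n} → (∀ u v → adj G u v ≡ adj H u v) → (n , G) ≐ (n , H)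

_≐?_ : Decidable _≐_
(m , G) ≐? (n , H) with m ℕ.≟ n
... | no m≢n = no λ { (same _) → m≢n refl }
... | yes refl = map′ same (λ { (same eq) → eq })
                      (Fin.all? λ u → Fin.all? λ v → adj G u v Bool.≟ adj H u v)

graphDecSetoid : DecSetoid 0ℓ 0ℓ
graphDecSetoid = record
  { Carrier = SomeGraph
  ; _≈_ = _≐_
  ; isDecEquivalence = record
    { isEquivalence = record
      { refl = same λ u v → refl
      ; sym = λ { (same eq) → same λ u v → ≡.sym (eq u v) }
      ; trans = λ { (same eq) (same eq′) → same λ u v → ≡.trans (eq u v) (eq′ u v) }
      }
    ; _≟_ = _≐?_
    }
  }

record _≅_ {m n : ℕ} (G : Graph m) (H : Graph n) : Set where
  field
    bijection : Permutation m n
    preserves : ∀ u v → adj G u v ≡ adj H (bijection ⟨$⟩ʳ u) (bijection ⟨$⟩ʳ v)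

module _ {n : ℕ} where

  joins : Fin n → Fin n → Fin n → Fin n → Bool
  joins x y u v = ⌊ u Fin.≟ x ×-dec v Fin.≟ y ⌋ ∨ ⌊ v Fin.≟ x ×-dec u Fin.≟ y ⌋

  joins-loopless : ∀ {x y} → x ≢ y → ∀ v → joins x y v v ≡ false
  joins-loopless {x} {y} x≢y v with v Fin.≟ x | v Fin.≟ y
  ... | yes refl | yes refl = ⊥-elim (x≢y refl)
  ... | yes _    | no _     = refl
  ... | no _     | _        = refl

  Edge : Set
  Edge = ∃ λ ((x , y) : Fin n × Fin n) → x ≢ y

  infixl 7 _∪ᵉ_
  _∪ᵉ_ : Graph n → Edge → Graph n
  G ∪ᵉ ((x , y) , x≢y) = record
    { adj       = λ u v → adj G u v ∨ joins x y u v
    ; symmetric = λ u v → cong₂ _∨_ (symmetric G u v) (∨-comm ⌊ u Fin.≟ x ×-dec v Fin.≟ y ⌋ _)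
    ; loopless  = λ v → cong₂ _∨_ (loopless G v) (joins-loopless x≢y v)
    }

-- A monomial x_{i₁} ⋯ x_{i_d} is the list of the indices i₁, …, i_d, taken up
-- to _↭_; its degree is the length.  Colors and variables are indexed from 0.
-- The monomial ∏_v x_{f(v)} of a coloring f is thus its list of values.
Monomial : Set
Monomial = List ℕ

Coloring : ℕ → Set
Coloring n = Vec ℕ n

Proper : ∀ {n} → Graph n → Pred (Coloring n) 0ℓ
Proper G f = ∀ u v → T (adj G u v) → lookup f u ≢ lookup f v

monomial : ∀ {n} → Coloring n → Monomial
monomial = toList

proper? : ∀ {n} (G : Graph n) → U.Decidable (Proper G)
proper? G f = Fin.all? λ u → Fin.all? λ v →
  T? (adj G u v) →-dec ¬? (lookup f u ℕ.≟ lookup f v)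

_↭?_ : Decidable (_↭_ {A = ℕ})
[]       ↭? []       = yes ↭-refl
[]       ↭? (y ∷ ys) = no (¬x∷xs↭[] ∘ ↭-sym)
(x ∷ xs) ↭? ys with x ∈? ys
... | no x∉ys = no λ p → x∉ys (∈-resp-↭ p (here refl))
... | yes x∈ys with us , vs , refl ← ∈-∃++ x∈ys =
  map′ (λ p → ↭-trans (↭-prep x p) (↭-sym (shift x us vs)))
       (λ p → drop-∷ (↭-trans p (shift x us vs)))
       (xs ↭? (us ++ vs))

vectors : {A : Set} → List A → ∀ n → List (Vec A n)
vectors xs zero    = [ [] ]
vectors xs (suc n) = cartesianProductWith _∷_ xs (vectors xs n)

vectors-unique : {A : Set} {xs : List A} → Unique xs → ∀ n → Unique (vectors xs n)
vectors-unique u zero    = [] ∷ []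
vectors-unique u (suc n) = Unique.cartesianProductWith⁺ _∷_ Vec.∷-injective u (vectors-unique u n)

∈-vectors : {A : Set} {xs : List A} → ∀ {n} (f : Vec A n) →
            (∀ {x} → x ∈ toList f → x ∈ xs) → f ∈ vectors xs n
∈-vectors []      f⊆xs = here refl
∈-vectors (x ∷ f) f⊆xs = ∈-cartesianProductWith⁺ _∷_ (f⊆xs (here refl)) (∈-vectors f (f⊆xs ∘ there))

contributes? : ∀ {n} (G : Graph n) (μ : Monomial) →
               U.Decidable (λ f → Proper G f × monomial f ↭ μ)
contributes? G μ f = proper? G f ×-dec monomial f ↭? μ

-- The proper colorings of G with monomial μ.  They only use colors occurring
-- in μ, so a finite search finds them all; see properColorings-complete.
properColorings : ∀ {n} → Graph n → Monomial → List (Coloring n)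
properColorings {n} G μ = filter (contributes? G μ) (vectors (deduplicate ℕ._≟_ μ) n)

properColorings-unique : ∀ {n} (G : Graph n) μ → Unique (properColorings G μ)
properColorings-unique {n} G μ =
  Unique.filter⁺ (contributes? G μ) (vectors-unique (deduplicate-! μ) n)

properColorings-sound : ∀ {n} (G : Graph n) {μ f} →
  f ∈ properColorings G μ → Proper G f × monomial f ↭ μ
properColorings-sound {n} G {μ} f∈ =
  proj₂ (∈-filter⁻ (contributes? G μ) {xs = vectors (deduplicate ℕ._≟_ μ) n} f∈)

properColorings-complete : ∀ {n} (G : Graph n) {μ f} →
  Proper G f × monomial f ↭ μ → f ∈ properColorings G μ
properColorings-complete G {μ} {f} fOK@(_ , f↭μ) =
  ∈-filter⁺ (contributes? G μ) (∈-vectors f (∈-deduplicate⁺ ℕ._≟_ ∘ ∈-resp-↭ f↭μ)) fOK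

same-length : {A : Set} {xs ys : List A} → Unique xs → Unique ys →
              (∀ {x} → x ∈ xs → x ∈ ys) → (∀ {x} → x ∈ ys → x ∈ xs) → length xs ≡ length ys
same-length uxs uys xs⊆ys ys⊆xs =
  ↭-length (∼bag⇒↭ (unique∧set⇒bag uxs uys (mk⇔ xs⊆ys ys⊆xs)))

count : ∀ {n} → Graph n → Monomial → ℕ
count G μ = length (properColorings G μ)

count-↭ : ∀ {n} (G : Graph n) {μ ν} → μ ↭ ν → count G μ ≡ count G ν
count-↭ G {μ} {ν} μ↭ν = same-length (properColorings-unique G μ) (properColorings-unique G ν)
  (λ f∈ → let p , q = properColorings-sound G f∈ in properColorings-complete G (p , ↭-trans q μ↭ν))
  (λ f∈ → let p , q = properColorings-sound G f∈ in properColorings-complete G (p , ↭-trans q (↭-sym μ↭ν)))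

count-≐ : ∀ {n} {G H : Graph n} → (∀ u v → adj G u v ≡ adj H u v) → ∀ μ → count G μ ≡ count H μ
count-≐ {G = G} {H} eq μ = same-length (properColorings-unique G μ) (properColorings-unique H μ)
  (λ f∈ → let p , q = properColorings-sound G f∈ in
    properColorings-complete H ((λ u v e → p u v (subst T (≡.sym (eq u v)) e)) , q))
  (λ f∈ → let p , q = properColorings-sound H f∈ in
    properColorings-complete G ((λ u v e → p u v (subst T (eq u v) e)) , q))

count-degree : ∀ {n} (G : Graph n) μ → n < length μ → count G μ ≡ 0
count-degree {n} G μ n<μ with properColorings G μ in eq
... | []    = refl
... | f ∷ _ = ⊥-elim (ℕ.<-irrefl (≡.trans (≡.sym (Vec.length-toList f)) (↭-length f↭μ)) n<μ)
  where
  f↭μ : monomial f ↭ μ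
  f↭μ = proj₂ (properColorings-sound G (subst (f ∈_) (≡.sym eq) (here refl)))

module _ (σ : ℕ ↔ ℕ) where
  open Inverse σ

  map-to-from : ∀ {n} (f : Coloring n) → Vec.map to (Vec.map from f) ≡ f
  map-to-from f = ≡.trans (≡.sym (Vec.map-∘ to from f))
    (≡.trans (Vec.map-cong (λ x → strictlyInverseˡ x) f) (Vec.map-id f))

  map-from-to : ∀ μ → map from (map to μ) ≡ μ
  map-from-to μ = ≡.trans (≡.sym (map-∘ μ))
    (≡.trans (map-cong (λ x → strictlyInverseʳ x) μ) (map-id μ))

  map-to-injective : ∀ {n} {f g : Coloring n} → Vec.map to f ≡ Vec.map to g → f ≡ g
  map-to-injective {f = []}    {[]}    _  = refl
  map-to-injective {f = x ∷ f} {y ∷ g} eq =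
    cong₂ _∷_ (Injection.injective (↔⇒↣ σ) (Vec.∷-injectiveˡ eq)) (map-to-injective (Vec.∷-injectiveʳ eq))

recolor : ∀ {n} (G : Graph n) (σ : ℕ ↔ ℕ) {μ f} → Proper G f × monomial f ↭ μ →
          Proper G (Vec.map (Inverse.to σ) f) × monomial (Vec.map (Inverse.to σ) f) ↭ map (Inverse.to σ) μ
recolor G σ {μ} {f} (proper , f↭μ) =
    (λ u v e eq → proper u v e (Injection.injective (↔⇒↣ σ)
      (≡.trans (≡.sym (Vec.lookup-map u to f)) (≡.trans eq (Vec.lookup-map v to f)))))
  , ↭-trans (↭-reflexive (Vec.toList-map to f)) (↭-map⁺ to f↭μ)
  where open Inverse σ

count-symmetric : ∀ {n} (G : Graph n) (σ : ℕ ↔ ℕ) μ → count G (map (Inverse.to σ) μ) ≡ count G μ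
count-symmetric G σ μ = ≡.trans
  (same-length (properColorings-unique G _)
    (Unique.map⁺ (map-to-injective σ) (properColorings-unique G μ)) back forth)
  (length-map (Vec.map to) (properColorings G μ))
  where
  open Inverse σ
  back : ∀ {f} → f ∈ properColorings G (map to μ) → f ∈ map (Vec.map to) (properColorings G μ)
  back {f} f∈ = subst (_∈ _) (map-to-from σ f) (∈-map⁺ (Vec.map to)
    (properColorings-complete G
      (let p , q = recolor G (↔-sym σ) (properColorings-sound G f∈)
       in p , ↭-trans q (↭-reflexive (map-from-to σ μ)))))
  forth : ∀ {f} → f ∈ map (Vec.map to) (properColorings G μ) → f ∈ properColorings G (map to μ)
  forth f∈ with g , g∈ , refl ← ∈-map⁻ (Vec.map to) f∈ =
    properColorings-complete G (recolor G σ (properColorings-sound G g∈))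

module ChromaticSymmetricFunctions (K : HeytingField c ℓ₁ ℓ₂) where

  open CommutativeRing (commutativeRing K)
  open RawMonoidDefinitions +-rawMonoid using () renaming (_×_ to _·_)

  -- Graphs of all sizes together freely generate the direct sum of the spaces
  -- freely generated by the graphs on n vertices.
  module 𝐅 = Free (commutativeRing K) graphDecSetoid

  𝐆 : LeftModule ring c ℓ₁
  𝐆 = 𝐅.leftModule

  ⟨_⟩ : ∀ {n} → Graph n → LeftModule.Carrierᴹ 𝐆
  ⟨ G ⟩ = 𝐅.⟨ _ , G ⟩

  -- A formal power series of bounded degree in the commuting variables
  -- x₀, x₁, …, invariant under permutations of the variables.
  record SymmetricFunction : Set (c ⊔ˡ ℓ₁) where
    field
      coeff     : Monomial → Carrier
      coeff-↭   : ∀ {μ ν} → μ ↭ ν → coeff μ ≈ coeff ν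
      bounded   : ∃ λ d → ∀ μ → d < length μ → coeff μ ≈ 0#
      symmetric : ∀ (σ : ℕ ↔ ℕ) μ → coeff (map (Inverse.to σ) μ) ≈ coeff μ

  open SymmetricFunction

  open RingProperties ring using (-0#≈0#)

  _⊕_ : SymmetricFunction → SymmetricFunction → SymmetricFunction
  p ⊕ q = record
    { coeff     = λ μ → coeff p μ + coeff q μ
    ; coeff-↭   = λ μ↭ν → +-cong (coeff-↭ p μ↭ν) (coeff-↭ q μ↭ν)
    ; bounded   = let d , p≈0 = bounded p ; e , q≈0 = bounded q in d ⊔ e , λ μ lt →
        trans (+-cong (p≈0 μ (ℕ.≤-<-trans (ℕ.m≤m⊔n d e) lt)) (q≈0 μ (ℕ.≤-<-trans (ℕ.m≤n⊔m d e) lt)))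
              (+-identityˡ 0#)
    ; symmetric = λ σ μ → +-cong (symmetric p σ μ) (symmetric q σ μ)
    }

  𝟘 : SymmetricFunction
  𝟘 = record
    { coeff     = λ _ → 0#
    ; coeff-↭   = λ _ → CommutativeRing.refl (commutativeRing K)
    ; bounded   = 0 , λ _ _ → CommutativeRing.refl (commutativeRing K)
    ; symmetric = λ _ _ → CommutativeRing.refl (commutativeRing K)
    }

  ⊖_ : SymmetricFunction → SymmetricFunction
  ⊖ p = record
    { coeff     = λ μ → - coeff p μ
    ; coeff-↭   = λ μ↭ν → -‿cong (coeff-↭ p μ↭ν)
    ; bounded   = let d , p≈0 = bounded p in d , λ μ lt → trans (-‿cong (p≈0 μ lt)) -0#≈0#
    ; symmetric = λ σ μ → -‿cong (symmetric p σ μ)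
    }

  _⊙_ : Carrier → SymmetricFunction → SymmetricFunction
  k ⊙ p = record
    { coeff     = λ μ → k * coeff p μ
    ; coeff-↭   = λ μ↭ν → *-congˡ (coeff-↭ p μ↭ν)
    ; bounded   = let d , p≈0 = bounded p in d , λ μ lt → trans (*-congˡ (p≈0 μ lt)) (zeroʳ k)
    ; symmetric = λ σ μ → *-congˡ (symmetric p σ μ)
    }

  ≈-refl : ∀ {x} → x ≈ x
  ≈-refl = CommutativeRing.refl (commutativeRing K)

  Sym : LeftModule ring (c ⊔ˡ ℓ₁) ℓ₁
  Sym = Pointwise.leftModule (commutativeRing K) coeff _⊕_ 𝟘 ⊖_ _⊙_
    (λ _ _ _ → ≈-refl) (λ _ → ≈-refl) (λ _ _ → ≈-refl) (λ _ _ _ → ≈-refl)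

  -- The coefficient of a monomial in Σ_f ∏_v x_{f(v)} is the number of proper
  -- colorings f with that monomial.
  chromatic : ∀ {n} → Graph n → SymmetricFunction
  chromatic {n} G = record
    { coeff     = λ μ → length (properColorings G μ) · 1#
    ; coeff-↭   = λ μ↭ν → reflexive (cong (_· 1#) (count-↭ G μ↭ν))
    ; bounded   = n , λ μ lt → reflexive (cong (_· 1#) (count-degree G μ lt))
    ; symmetric = λ σ μ → reflexive (cong (_· 1#) (count-symmetric G σ μ))
    }

  chromatic-cong : ∀ {G H : SomeGraph} → G ≐ H →
                   LeftModule._≈ᴹ_ Sym (chromatic (proj₂ G)) (chromatic (proj₂ H))
  chromatic-cong (same {n} {G} {H} eq) μ = reflexive (cong (_· 1#) (count-≐ {n} {G} {H} eq μ))

  Ψ : LinearMap 𝐆 Sym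
  Ψ = 𝐅.Extension.linearMap Sym (λ G → chromatic (proj₂ G)) chromatic-cong

  open LeftModule 𝐆 using (_+ᴹ_; -ᴹ_)

  data ModularRelation : Pred (LeftModule.Carrierᴹ 𝐆) c where
    modular : ∀ {n} (G : Graph n) {x y z : Fin n} (x≢y : x ≢ y) (y≢z : y ≢ z) (x≢z : x ≢ z) →
      let e₁ = (x , y) , x≢y
          e₂ = (y , z) , y≢z
      in
      adj G x z ≡ true → adj G x y ≡ false → adj G y z ≡ false →
      ModularRelation (⟨ G ⟩ +ᴹ -ᴹ ⟨ G ∪ᵉ e₁ ⟩ +ᴹ -ᴹ ⟨ G ∪ᵉ e₂ ⟩ +ᴹ ⟨ G ∪ᵉ e₁ ∪ᵉ e₂ ⟩)

  data IsomorphismRelation : Pred (LeftModule.Carrierᴹ 𝐆) c where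
    isomorphism : ∀ {m n} (G : Graph m) (H : Graph n) → G ≅ H →
      IsomorphismRelation (⟨ G ⟩ +ᴹ -ᴹ ⟨ H ⟩)

{-# OPTIONS --safe #-}
-- For a coloring μ of [n] let M(μ) be the graph joining the vertices of different colors.  If
-- nonadjacency in G is not transitive, say x ≁ y ≁ z but x ~ z, a modular relation expresses G
-- through graphs with fewer nonedges; otherwise G is isomorphic to M(μ), where μ colors a vertex by
-- its nonadjacency class.  So modulo the relations 𝐆 is spanned by the graphs M(μ), one for each μ
-- up to renaming colors and permuting vertices.
--
-- A proper coloring of M(ν) is constant only inside the classes of ν, so it uses at least as many
-- colors as ν, and as many only if it is ν up to renaming.  Hence the matrix of coefficients of
-- the monomials μ in Ψ(M(ν)) is triangular once the μ are ordered by their number of colors, with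
-- nonzero diagonal, which is invertible in characteristic zero.  Solving the triangular system with
-- right-hand side 0 computes the kernel; with an arbitrary one it gives surjectivity.

module Submission where

open import Algebra.Apartness.Bundles using (HeytingField)
open import Algebra.Bundles using (Ring; CommutativeRing; CommutativeMonoid)
import Algebra.Definitions.RawMonoid as RawMonoidDefinitions
open import Algebra.Module.Bundles using (LeftModule)
import Algebra.Properties.AbelianGroup as AbelianGroupProperties
import Algebra.Properties.CommutativeSemigroup as CommutativeSemigroupProperties
import Algebra.Properties.Monoid.Mult as MonoidMultiplication
import Algebra.Properties.Ring as RingProperties
open import Data.Bool.Base using (if_then_else_; Bool; true; false; not; T)
import Data.Bool.Properties as Bool
open import Data.Fin.Base using (Fin; zero; suc; cast)
open import Data.Fin.Permutation using (Permutation; _⟨$⟩ʳ_; _⟨$⟩ˡ_; cast-id; _∘ₚ_)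
import Data.Fin.Permutation as Permutation
import Data.Fin.Properties as Fin
open import Data.List.Base
  using (List; []; _∷_; _++_; map; filter; length; deduplicate; upTo; concatMap; allFin; cartesianProduct)
import Data.List.Base as List
open import Data.List.Membership.Propositional using (_∈_; _∉_; lose; find)
open import Data.List.Membership.Propositional.Properties
  using (∈-deduplicate⁺; ∈-deduplicate⁻; ∈-filter⁺; ∈-filter⁻; ∈-map⁺; ∈-map⁻; ∈-++⁺ˡ; ∈-++⁺ʳ; ∈-++⁻;
    ∈-cartesianProduct⁺; ∈-allFin; ∈-upTo⁺; ∈-upTo⁻; ∈-concatMap⁺; ∈-concatMap⁻)
open import Data.List.Membership.Propositional.Properties.WithK using (unique∧set⇒bag)
import Data.List.Properties as List
open import Data.List.Relation.Binary.BagAndSetEquality using (∼bag⇒↭)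
open import Data.List.Relation.Binary.Permutation.Homogeneous using (onIndices)
open import Data.List.Relation.Binary.Permutation.Propositional
  using (_↭_; ↭-sym; ↭-trans; ↭-reflexive; ↭⇒↭ₛ; module PermutationReasoning)
open import Data.List.Relation.Binary.Permutation.Propositional.Properties
  using (∈-resp-↭) renaming (map⁺ to ↭-map⁺)
open import Data.List.Relation.Binary.Permutation.Setoid.Properties using (onIndices-lookup)
open import Data.List.Relation.Unary.All as All using (All; []; _∷_)
open import Data.List.Relation.Unary.AllPairs using (AllPairs; []; _∷_)
import Data.List.Relation.Unary.AllPairs.Properties as AllPairs
open import Data.List.Relation.Unary.Any as Any using (here; there)
import Data.List.Relation.Unary.Unique.Propositional.Properties as Unique
open import Data.Nat.Base using (ℕ; zero; suc; _≤_; _<_; _⊔_; z≤n; s≤s) renaming (_+_ to _+ℕ_)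
open import Data.Nat.Induction using (Acc; acc; <-wellFounded)
import Data.Nat.Properties as ℕ
open import Data.List.Membership.DecPropositional ℕ._≟_ using (_∈?_)
open import Data.List.Relation.Unary.Unique.DecPropositional.Properties ℕ._≟_ using (deduplicate-!)
open import Data.Product.Base using (∃; _×_; _,_; proj₁; proj₂)
open import Data.Sum.Base using (_⊎_; inj₁; inj₂; [_,_])
open import Data.Vec.Base using (Vec; []; _∷_; lookup; toList; fromList)
import Data.Vec.Base as Vec
import Data.Vec.Properties as Vec
open import Function.Base using (_∘_; id)
open import Function.Bundles using (_↔_; mk⇔; module Equivalence; mk↔ₛ′; module Inverse; module Injection)
open import Function.Construct.Composition using (_↔-∘_)
import Function.Construct.Identity as Identity
open import Function.Definitions using (StrictlySurjective)
open import Function.Properties.Inverse using (↔⇒↣; ↔-sym)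
open import Level using (0ℓ) renaming (_⊔_ to _⊔ˡ_)
open import Relation.Binary.PropositionalEquality using (_≡_; _≢_; refl; sym; trans; cong; cong₂; subst)
import Relation.Binary.PropositionalEquality as ≡
import Relation.Binary.Reasoning.Setoid as SetoidReasoning
open import Relation.Nullary using (yes; no; does; ¬_; ¬?; _×-dec_; contradiction)
open import Relation.Nullary.Decidable using (does-⇔; dec-true; decidable-stable)
import Relation.Unary as U
open import Relation.Unary using (Pred; _≐_; _∪_; _⊆_)
open import Defs hiding (_≐_)

open Graph

private
  variable
    n : ℕ

-- Numbers of colors and refinement of colorings.

distinct : List ℕ → ℕ
distinct xs = length (deduplicate ℕ._≟_ xs)

distinct-cong : ∀ {xs ys} → (∀ {x} → x ∈ xs → x ∈ ys) → (∀ {x} → x ∈ ys → x ∈ xs) → distinct xs ≡ distinct ys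
distinct-cong {xs} {ys} xs⊆ys ys⊆xs = same-length (deduplicate-! xs) (deduplicate-! ys)
  (∈-deduplicate⁺ ℕ._≟_ ∘ xs⊆ys ∘ ∈-deduplicate⁻ ℕ._≟_ xs)
  (∈-deduplicate⁺ ℕ._≟_ ∘ ys⊆xs ∘ ∈-deduplicate⁻ ℕ._≟_ ys)

distinct-↭ : ∀ {xs ys} → xs ↭ ys → distinct xs ≡ distinct ys
distinct-↭ p = distinct-cong (∈-resp-↭ p) (∈-resp-↭ (↭-sym p))

distinct-∈ : ∀ {x xs} → x ∈ xs → distinct (x ∷ xs) ≡ distinct xs
distinct-∈ x∈xs = distinct-cong (λ { (here refl) → x∈xs ; (there y∈) → y∈ }) there

distinct-∉ : ∀ {x xs} → x ∉ xs → distinct (x ∷ xs) ≡ suc (distinct xs)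
distinct-∉ {x} {xs} x∉xs = cong (suc ∘ length) (List.filter-all (¬? ∘ (x ℕ.≟_))
  (All.tabulate λ { y∈ refl → x∉xs (∈-deduplicate⁻ ℕ._≟_ xs y∈) }))

distinct-∷-≤ : ∀ x xs → distinct (x ∷ xs) ≤ suc (distinct xs)
distinct-∷-≤ x xs = s≤s (List.length-filter (¬? ∘ (x ℕ.≟_)) (deduplicate ℕ._≟_ xs))

lookup-∈ : ∀ (xs : Vec ℕ n) i → lookup xs i ∈ toList xs
lookup-∈ (x ∷ xs) zero    = here refl
lookup-∈ (x ∷ xs) (suc i) = there (lookup-∈ xs i)

∈-lookup⁻ : ∀ (xs : Vec ℕ n) {x} → x ∈ toList xs → ∃ λ i → lookup xs i ≡ x
∈-lookup⁻ (x ∷ xs) (here refl) = zero , refl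
∈-lookup⁻ (x ∷ xs) (there x∈)  = let i , eq = ∈-lookup⁻ xs x∈ in suc i , eq

infix 4 _Refines_
-- The partition of the positions into color classes of `xs` is finer than that of `ys`. The record
-- lets `xs` and `ys` be inferred from a proof, unlike the bare function type.
record _Refines_ (xs ys : Vec ℕ n) : Set where
  constructor refining
  field
    refine : ∀ i j → lookup xs i ≡ lookup xs j → lookup ys i ≡ lookup ys j

open _Refines_

module _ {n} {x y} {xs ys : Vec ℕ n} (r : (x ∷ xs) Refines (y ∷ ys)) where

  refines-tail : xs Refines ys
  refines-tail = refining λ i j → refine r (suc i) (suc j)

  refines-head : x ∈ toList xs → y ∈ toList ys
  refines-head x∈ with i , eq ← ∈-lookup⁻ xs x∈ =
    subst (_∈ toList ys) (refine r (suc i) zero eq) (lookup-∈ ys i)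

-- A recurring head color of `xs` forces a recurring head color of `ys`; a new one adds exactly one
-- color to `xs` but at most one to `ys`.
refines⇒distinct-≥ : ∀ {xs ys : Vec ℕ n} → xs Refines ys → distinct (toList ys) ≤ distinct (toList xs)
refines⇒distinct-≥ {xs = []}     {[]}     r = z≤n
refines⇒distinct-≥ {xs = x ∷ xs} {y ∷ ys} r with x ∈? toList xs
... | yes x∈ rewrite distinct-∈ x∈ | distinct-∈ (refines-head r x∈) = refines⇒distinct-≥ (refines-tail r)
... | no x∉ rewrite distinct-∉ x∉ =
  ℕ.≤-trans (distinct-∷-≤ y (toList ys)) (s≤s (refines⇒distinct-≥ (refines-tail r)))

-- A finer partition with no more classes is the same partition. The bound passes to the tails, so
-- only the head remains to be compared with the later entries.
refines-sym : ∀ {xs ys : Vec ℕ n} → xs Refines ys → distinct (toList xs) ≤ distinct (toList ys) → ys Refines xs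
refines-sym {xs = []}     {[]}     _ _  = refining λ ()
refines-sym {xs = x ∷ xs} {y ∷ ys} r le = refining λ
  { zero    zero    _  → refl
  ; zero    (suc j) eq → head j eq
  ; (suc i) zero    eq → sym (head i (sym eq))
  ; (suc i) (suc j) eq → refine tail i j eq
  }
  where
  tail-le : distinct (toList xs) ≤ distinct (toList ys)
  tail-le with x ∈? toList xs
  ... | yes x∈ = ≡.subst₂ _≤_ (distinct-∈ x∈) (distinct-∈ (refines-head r x∈)) le
  ... | no x∉  = ℕ.≤-pred (subst (_≤ suc (distinct (toList ys))) (distinct-∉ x∉) (ℕ.≤-trans le (distinct-∷-≤ y (toList ys))))
  tail = refines-sym (refines-tail r) tail-le
  head : ∀ j → y ≡ lookup ys j → x ≡ lookup xs j
  head j eq with x ∈? toList xs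
  ... | yes x∈ with i , xi≡x ← ∈-lookup⁻ xs x∈ =
    trans (sym xi≡x) (refine tail i j (trans (refine r (suc i) zero xi≡x) eq))
  -- If `x` is new while `y` recurs, the bound makes one more than the number of colors of the tail
  -- `xs` at most that of the tail `ys`, hence at most itself.
  ... | no x∉ = contradiction
    (ℕ.≤-trans (ℕ.≤-reflexive (sym (distinct-∉ x∉)))
      (ℕ.≤-trans le (ℕ.≤-trans (ℕ.≤-reflexive (distinct-∈ (subst (_∈ toList ys) (sym eq) (lookup-∈ ys j))))
        (refines⇒distinct-≥ (refines-tail r)))))
    (ℕ.<-irrefl refl)

module _ (a b : ℕ) where

  transpose : ℕ → ℕ
  transpose x with x ℕ.≟ a | x ℕ.≟ b
  ... | yes _ | _     = b
  ... | no _  | yes _ = a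
  ... | no _  | no _  = x

  transpose-left : transpose a ≡ b
  transpose-left with a ℕ.≟ a
  ... | yes _  = refl
  ... | no a≢a = contradiction refl a≢a

  transpose-right : transpose b ≡ a
  transpose-right with b ℕ.≟ a | b ℕ.≟ b
  ... | yes b≡a | _     = b≡a
  ... | no _  | yes _  = refl
  ... | no _  | no b≢b = contradiction refl b≢b

  transpose-other : ∀ {x} → x ≢ a → x ≢ b → transpose x ≡ x
  transpose-other {x} x≢a x≢b with x ℕ.≟ a | x ℕ.≟ b
  ... | yes x≡a | _       = contradiction x≡a x≢a
  ... | no _    | yes x≡b = contradiction x≡b x≢b
  ... | no _    | no _    = refl

  transpose-involutive : ∀ x → transpose (transpose x) ≡ x
  transpose-involutive x with x ℕ.≟ a | x ℕ.≟ b
  ... | yes refl | _        = transpose-right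
  ... | no _     | yes refl = transpose-left
  ... | no x≢a   | no x≢b   = transpose-other x≢a x≢b

  transposition : ℕ ↔ ℕ
  transposition = mk↔ₛ′ transpose transpose transpose-involutive transpose-involutive

-- The matching of color classes is extended to a bijection of all of ℕ, since symmetric functions
-- are invariant under those.
refines⇒recoloring : ∀ {xs ys : Vec ℕ n} → xs Refines ys → ys Refines xs →
                     ∃ λ (σ : ℕ ↔ ℕ) → ∀ i → lookup ys i ≡ Inverse.to σ (lookup xs i)
refines⇒recoloring {xs = []} {[]} _ _ = Identity.↔-id ℕ , λ ()
refines⇒recoloring {xs = x ∷ xs} {y ∷ ys} r s
  with σ , eq ← refines⇒recoloring (refines-tail r) (refines-tail s) | x ∈? toList xs
... | yes x∈ with i , xi≡x ← ∈-lookup⁻ xs x∈ = σ , λ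
  { zero    → trans (sym (refine r (suc i) zero xi≡x)) (trans (eq i) (cong (Inverse.to σ) xi≡x))
  ; (suc j) → eq j
  }
-- Here `x` and `y` are both new, so neither `σ x` nor `y` is among the colors that `σ` gives to the
-- tail. Swapping them corrects the head and leaves the tail alone.
... | no x∉ = transposition (Inverse.to σ x) y ↔-∘ σ , λ
  { zero    → sym (transpose-left (Inverse.to σ x) y)
  ; (suc j) → trans (eq j) (sym (transpose-other _ y
      (λ σxj≡σx → x∉ (subst (_∈ toList xs) (Injection.injective (↔⇒↣ σ) σxj≡σx) (lookup-∈ xs j)))
      (λ σxj≡y → x∉ (subst (_∈ toList xs) (refine s (suc j) zero (trans (eq j) σxj≡y)) (lookup-∈ xs j)))))
  }

-- The complete multipartite graphs M(μ) and their proper colorings.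

multipartite : (μ : Monomial) → Graph (length μ)
multipartite μ = record
  { adj       = λ u v → not (does (List.lookup μ u ℕ.≟ List.lookup μ v))
  ; symmetric = λ u v → cong not (does-⇔ (mk⇔ sym sym) (List.lookup μ u ℕ.≟ List.lookup μ v) (_ ℕ.≟ _))
  ; loopless  = λ v → cong not (dec-true (List.lookup μ v ℕ.≟ _) refl)
  }

lookup-fromList : ∀ (μ : List ℕ) i → lookup (fromList μ) i ≡ List.lookup μ i
lookup-fromList (x ∷ μ) zero    = refl
lookup-fromList (x ∷ μ) (suc i) = lookup-fromList μ i

lookup-toList : ∀ (xs : Vec ℕ n) .(eq : n ≡ length (toList xs)) i → List.lookup (toList xs) (cast eq i) ≡ lookup xs i
lookup-toList (x ∷ xs) eq zero    = refl
lookup-toList (x ∷ xs) eq (suc i) = lookup-toList xs (ℕ.suc-injective eq) i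

nonadjacent⇒≡ : ∀ μ u v → adj (multipartite μ) u v ≡ false → List.lookup μ u ≡ List.lookup μ v
-- The value `false` is read as `not true`, and the boolean of `ℕ._≟_` computes to `≡ᵇ`.
nonadjacent⇒≡ μ u v eq = ℕ.≡ᵇ⇒≡ _ _ (subst T (sym (Bool.not-injective {y = true} eq)) _)

≡⇒nonadjacent : ∀ μ u v → List.lookup μ u ≡ List.lookup μ v → adj (multipartite μ) u v ≡ false
≡⇒nonadjacent μ u v eq = cong not (dec-true (List.lookup μ u ℕ.≟ _) eq)

proper⇒refines : ∀ {μ} {f : Coloring (length μ)} → Proper (multipartite μ) f → f Refines fromList μ
proper⇒refines {μ} {f} p = refining λ i j → go i j
  where
  go : ∀ i j → lookup f i ≡ lookup f j → lookup (fromList μ) i ≡ lookup (fromList μ) j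
  go i j fi≡fj with adj (multipartite μ) i j in eq
  ... | true  = contradiction fi≡fj (p i j (subst T (sym eq) _))
  ... | false = trans (lookup-fromList μ i) (trans (nonadjacent⇒≡ μ i j eq) (sym (lookup-fromList μ j)))

fromList-proper : ∀ μ → Proper (multipartite μ) (fromList μ)
fromList-proper μ u v e eq = subst T (≡⇒nonadjacent μ u v
  (trans (sym (lookup-fromList μ u)) (trans eq (lookup-fromList μ v)))) e

count≢0⁺ : ∀ (G : Graph n) {μ f} → Proper G f × monomial f ↭ μ → count G μ ≢ 0
count≢0⁺ G {μ} fOK eq with properColorings G μ | properColorings-complete G fOK
count≢0⁺ G {μ} fOK () | _ ∷ _ | _

count≢0⁻ : ∀ (G : Graph n) {μ} → count G μ ≢ 0 → ∃ λ f → Proper G f × monomial f ↭ μ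
count≢0⁻ G {μ} ne with properColorings G μ in eq
... | []    = contradiction refl ne
... | f ∷ _ = f , properColorings-sound G (subst (f ∈_) (sym eq) (here refl))

count-diagonal : ∀ μ → count (multipartite μ) μ ≢ 0
count-diagonal μ = count≢0⁺ (multipartite μ) (fromList-proper μ , ↭-reflexive (Vec.toList∘fromList μ))

infix 4 _∼_
-- The two ingredients match the fields `coeff-↭` and `symmetric` of a symmetric function, whose
-- coefficients are therefore constant on the classes.
_∼_ : Monomial → Monomial → Set
μ ∼ ν = ∃ λ (σ : ℕ ↔ ℕ) → μ ↭ map (Inverse.to σ) ν

recoloring : ∀ {xs ys : Vec ℕ n} → xs Refines ys → ys Refines xs → toList ys ∼ toList xs
recoloring {xs = xs} {ys} r s with σ , eq ← refines⇒recoloring r s = σ , ↭-reflexive (go xs ys eq)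
  where
  go : ∀ {n} (xs ys : Vec ℕ n) → (∀ i → lookup ys i ≡ Inverse.to σ (lookup xs i)) →
       toList ys ≡ map (Inverse.to σ) (toList xs)
  go []       []       eq = refl
  go (x ∷ xs) (y ∷ ys) eq = cong₂ _∷_ (eq zero) (go xs ys (eq ∘ suc))

count≢0⇒distinct-≤ : ∀ {μ ν} → count (multipartite ν) μ ≢ 0 → distinct ν ≤ distinct μ
count≢0⇒distinct-≤ {μ} {ν} ne with f , p , f↭μ ← count≢0⁻ (multipartite ν) ne =
  ≡.subst₂ _≤_ (cong distinct (Vec.toList∘fromList ν)) (distinct-↭ f↭μ) (refines⇒distinct-≥ (proper⇒refines {ν} {f} p))

-- The coloring behind the nonzero count refines `ν` and has no more colors, so by `refines-sym`
-- both have the same color classes.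
count≢0⇒∼ : ∀ {μ ν} → count (multipartite ν) μ ≢ 0 → distinct μ ≤ distinct ν → μ ∼ ν
count≢0⇒∼ {μ} {ν} ne le with f , p , f↭μ ← count≢0⁻ (multipartite ν) ne =
  let σ , q = recoloring (refines-sym r le′) r
  in σ , ↭-trans (↭-sym f↭μ) (↭-trans q (↭-reflexive (cong (map (Inverse.to σ)) (Vec.toList∘fromList ν))))
  where
  r : f Refines fromList ν
  r = proper⇒refines {ν} p
  le′ : distinct (toList f) ≤ distinct (toList (fromList ν))
  le′ = ≡.subst₂ _≤_ (sym (distinct-↭ f↭μ)) (cong distinct (sym (Vec.toList∘fromList ν))) le

≅-sym : ∀ {m} {G : Graph m} {H : Graph n} → G ≅ H → H ≅ G
≅-sym {G = G} {H} i = record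
  { bijection = ↔-sym bijection
  ; preserves = λ u v → sym (trans (preserves (bijection ⟨$⟩ˡ u) (bijection ⟨$⟩ˡ v))
      (cong₂ (adj H) (Permutation.inverseʳ bijection) (Permutation.inverseʳ bijection)))
  }
  where open _≅_ i

-- The permutation of positions behind `↭` matches the vertices. It changes their colors by the
-- injective `σ`, so equal colors stay equal and different ones different.
∼⇒≅ : ∀ {μ ν} → μ ∼ ν → multipartite ν ≅ multipartite μ
∼⇒≅ {μ} {ν} (σ , p) = record
  { bijection = π
  ; preserves = λ u v → cong not (does-⇔ (mk⇔
      (λ eq → trans (lookup-π u) (trans (cong to eq) (sym (lookup-π v))))
      (λ eq → Injection.injective (↔⇒↣ σ) (trans (sym (lookup-π u)) (trans eq (lookup-π v)))))
      (List.lookup ν u ℕ.≟ List.lookup ν v) (_ ℕ.≟ _))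
  }
  where
  open Inverse σ
  q = ↭⇒↭ₛ (↭-sym p)
  π : Permutation (length ν) (length μ)
  π = cast-id (sym (List.length-map to ν)) ∘ₚ onIndices q
  lookup-map : ∀ ν .(eq : length ν ≡ length (map to ν)) i → List.lookup (map to ν) (cast eq i) ≡ to (List.lookup ν i)
  lookup-map (x ∷ ν) eq zero    = refl
  lookup-map (x ∷ ν) eq (suc i) = lookup-map ν (ℕ.suc-injective eq) i
  lookup-π : ∀ i → List.lookup μ (π ⟨$⟩ʳ i) ≡ to (List.lookup ν i)
  lookup-π i = trans (sym (onIndices-lookup (≡.setoid ℕ) q (cast (sym (List.length-map to ν)) i))) (lookup-map ν _ i)

-- Graphs with transitive nonadjacency.

first : (Fin n → Bool) → ℕ
first {zero}  f = 0
first {suc n} f = if f zero then suc (first (f ∘ suc)) else 0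

first-≤ : (f : Fin n → Bool) → first f ≤ n
first-≤ {zero}  f = z≤n
first-≤ {suc n} f with f zero
... | true  = s≤s (first-≤ (f ∘ suc))
... | false = z≤n

first-cong : {f g : Fin n → Bool} → (∀ i → f i ≡ g i) → first f ≡ first g
first-cong {zero}          eq = refl
first-cong {suc n} {f} {g} eq rewrite eq zero = cong (λ k → if g zero then suc k else 0) (first-cong (eq ∘ suc))

-- The values at `i` and `j` exclude the default `n` of `first`, so the common value is an index at
-- which both functions are false.
first-common : {f g : Fin n → Bool} → ∀ i j → f i ≡ false → g j ≡ false → first f ≡ first g →
               ∃ λ k → f k ≡ false × g k ≡ false
first-common {suc n} {f} {g} i j fi gj eq with f zero in f0 | g zero in g0
first-common         i       j       fi gj eq | false | false = zero , f0 , g0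
first-common         zero    j       fi gj eq | true  | true  = contradiction (trans (sym f0) fi) λ ()
first-common         (suc i) zero    fi gj eq | true  | true  = contradiction (trans (sym g0) gj) λ ()
first-common         (suc i) (suc j) fi gj eq | true  | true  =
  let k , fk , gk = first-common i j fi gj (ℕ.suc-injective eq) in suc k , fk , gk

NonadjacencyTransitive : Graph n → Set
NonadjacencyTransitive G = ∀ x y z → adj G x y ≡ false → adj G y z ≡ false → adj G x z ≡ false

multipartite-transitive : ∀ μ → NonadjacencyTransitive (multipartite μ)
multipartite-transitive μ x y z xy yz =
  ≡⇒nonadjacent μ x z (trans (nonadjacent⇒≡ μ x y xy) (nonadjacent⇒≡ μ y z yz))

-- When nonadjacency is transitive, it is an equivalence relation, and the first nonneighbor of a
-- vertex is the least member of its class.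
classes : Graph n → Coloring n
classes G = Vec.tabulate (first ∘ adj G)

lookup-classes : ∀ (G : Graph n) u → lookup (classes G) u ≡ first (adj G u)
lookup-classes G = Vec.lookup∘tabulate (first ∘ adj G)

module _ (G : Graph n) (transitive : NonadjacencyTransitive G) where

  nonadjacent-sym : ∀ u v → adj G u v ≡ false → adj G v u ≡ false
  nonadjacent-sym u v = trans (symmetric G v u)

  -- By transitivity, nonadjacent vertices have the same row in the adjacency matrix.
  nonadjacent⇒classes-≡ : ∀ u v → adj G u v ≡ false → lookup (classes G) u ≡ lookup (classes G) v
  nonadjacent⇒classes-≡ u v uv = trans (lookup-classes G u) (trans (first-cong rows) (sym (lookup-classes G v)))
    where
    rows : ∀ w → adj G u w ≡ adj G v w
    rows w with adj G u w in uw | adj G v w in vw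
    ... | true  | true  = refl
    ... | false | false = refl
    ... | false | true  = contradiction (trans (sym vw) (transitive v u w (nonadjacent-sym u v uv) uw)) λ ()
    ... | true  | false = contradiction (trans (sym uw) (transitive u v w uv vw)) λ ()

  -- Each vertex is a nonneighbor of itself, so `first-common` applies to the two rows and yields a
  -- common nonneighbor `w`; transitivity goes through `w`.
  classes-≡⇒nonadjacent : ∀ u v → lookup (classes G) u ≡ lookup (classes G) v → adj G u v ≡ false
  classes-≡⇒nonadjacent u v eq =
    let w , uw , vw = first-common u v (loopless G u) (loopless G v)
                        (trans (sym (lookup-classes G u)) (trans eq (lookup-classes G v)))
    in transitive u w v uw (nonadjacent-sym v w vw)

  transitive⇒multipartite : G ≅ multipartite (toList (classes G))
  transitive⇒multipartite = record { bijection = cast-id length-eq ; preserves = preserves }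
    where
    μ = toList (classes G)
    length-eq : n ≡ length μ
    length-eq = sym (Vec.length-toList (classes G))
    lookup-μ = lookup-toList (classes G) length-eq
    preserves : ∀ u v → adj G u v ≡ adj (multipartite μ) (cast length-eq u) (cast length-eq v)
    preserves u v with adj G u v in uv
    ... | false = sym (≡⇒nonadjacent μ (cast length-eq u) (cast length-eq v)
                    (trans (lookup-μ u) (trans (nonadjacent⇒classes-≡ u v uv) (sym (lookup-μ v)))))
    ... | true with adj (multipartite μ) (cast length-eq u) (cast length-eq v) in uv′
    ...   | true  = refl
    ...   | false = contradiction (trans (sym uv) (classes-≡⇒nonadjacent u v
                      (trans (sym (lookup-μ u)) (trans (nonadjacent⇒≡ μ _ _ uv′) (lookup-μ v))))) λ ()

-- A monomial may use arbitrarily large colors; this replaces it by an equivalent one that belongs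
-- to a finite list `monomials d`.
classes-∼ : ∀ μ → toList (classes (multipartite μ)) ∼ μ
classes-∼ μ = subst (toList (classes (multipartite μ)) ∼_) (Vec.toList∘fromList μ) (recoloring
  (refining λ u v eq → nonadjacent⇒classes-≡ (multipartite μ) (multipartite-transitive μ) u v
    (≡⇒nonadjacent μ u v (trans (sym (lookup-fromList μ u)) (trans eq (lookup-fromList μ v)))))
  (refining λ u v eq → trans (lookup-fromList μ u) (trans (nonadjacent⇒≡ μ u v
    (classes-≡⇒nonadjacent (multipartite μ) (multipartite-transitive μ) u v eq)) (sym (lookup-fromList μ v)))))

-- Finite lists of monomials and their triangular bases.

homogeneous : ℕ → List Monomial
-- The bound `first-≤` admits the value `n`, so the colors run from 0 to `n` inclusive.
homogeneous n = map toList (vectors (upTo (suc n)) n)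

monomials : ℕ → List Monomial
monomials d = concatMap homogeneous (upTo (suc d))

classes-∈-monomials : ∀ {d} (G : Graph n) → n ≤ d → toList (classes G) ∈ monomials d
classes-∈-monomials {n} G n≤d = ∈-concatMap⁺ homogeneous (lose (∈-upTo⁺ (s≤s n≤d)) (∈-map⁺ toList (∈-vectors (classes G) bound)))
  where
  bound : ∀ {x} → x ∈ toList (classes G) → x ∈ upTo (suc n)
  bound x∈ with u , refl ← ∈-lookup⁻ (classes G) x∈ rewrite lookup-classes G u = ∈-upTo⁺ (s≤s (first-≤ (adj G u)))

monomials-length : ∀ {d μ} → μ ∈ monomials d → length μ ≤ d
monomials-length {d} μ∈ with n , n∈ , μ∈′ ← find (∈-concatMap⁻ homogeneous {xs = upTo (suc d)} μ∈)
  with f , _ , eq ← ∈-map⁻ toList μ∈′ =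
  ℕ.≤-trans (ℕ.≤-reflexive (trans (cong length eq) (Vec.length-toList f))) (ℕ.≤-pred (∈-upTo⁻ n∈))

-- A zero of the coefficient matrix in row `μ` and column `ν`. Under `AllPairs`, `μ` comes before
-- `ν` in the list.
Triangular : Monomial → Monomial → Set
Triangular μ ν = count (multipartite ν) μ ≡ 0

distinct-<⇒triangular : ∀ {μ ν} → distinct μ < distinct ν → Triangular μ ν
distinct-<⇒triangular {μ} {ν} lt = decidable-stable (_ ℕ.≟ 0) λ ne → ℕ.<⇒≱ lt (count≢0⇒distinct-≤ {μ} {ν} ne)

-- Representatives of the classes of `∼` that meet `C`, in a suitable order. Two equivalent members
-- cannot both occur, because the corresponding count would be nonzero.
record TriangularBasis (C : List Monomial) : Set where
  field
    basis      : List Monomial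
    triangular : AllPairs Triangular basis
    sound      : ∀ {μ} → μ ∈ basis → μ ∈ C
    complete   : ∀ {μ} → μ ∈ C → ∃ λ ν → ν ∈ basis × ν ∼ μ

∼-refl : ∀ {μ} → μ ∼ μ
∼-refl {μ} = Identity.↔-id ℕ , ↭-reflexive (sym (List.map-id μ))

-- Insertion sort by the number of colors. As `∼` quantifies over bijections of ℕ, equivalence to
-- `κ` is tested through a finite count instead.
triangularBasis : ∀ C → TriangularBasis C
triangularBasis [] = record { basis = [] ; triangular = [] ; sound = λ () ; complete = λ () }
triangularBasis (κ ∷ C) with B ← triangularBasis C
  with Any.any? (λ μ → distinct μ ℕ.≤? distinct κ ×-dec ¬? (count (multipartite κ) μ ℕ.≟ 0)) (TriangularBasis.basis B)
-- By `count≢0⇒∼` the monomial found is equivalent to `κ`, which is thus represented already.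
... | yes found = record
  { basis = basis
  ; triangular = triangular
  ; sound = there ∘ sound
  ; complete = λ
    { (here refl) → let μ , μ∈ , le , ne = find found in μ , μ∈ , count≢0⇒∼ ne le
    ; (there μ∈)  → complete μ∈
    }
  }
  where open TriangularBasis B
-- κ goes just before the basis elements with more colors.  The others precede it: by the failed
-- search, none of them is the monomial of a proper coloring of M(κ).
... | no none = record
  { basis = below ++ κ ∷ above
  ; triangular = AllPairs.++⁺ (AllPairs.filter⁺ low? triangular)
      (All.tabulate (λ {ν} μ∈ → distinct-<⇒triangular {κ} {ν} (ℕ.≰⇒> (proj₂ (∈-filter⁻ (¬? ∘ low?) {xs = basis} μ∈))))
        ∷ AllPairs.filter⁺ (¬? ∘ low?) triangular)
      (All.tabulate λ μ∈ → below-κ μ∈ ∷ All.tabulate λ ν∈ → below-above μ∈ ν∈)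
  ; sound = λ μ∈ → [ there ∘ sound ∘ proj₁ ∘ ∈-filter⁻ low? {xs = basis}
                   , (λ { (here refl) → here refl
                        ; (there ν∈) → there (sound (proj₁ (∈-filter⁻ (¬? ∘ low?) {xs = basis} ν∈))) })
                   ] (∈-++⁻ below μ∈)
  ; complete = λ
    { (here refl) → κ , ∈-++⁺ʳ below (here refl) , ∼-refl
    ; (there μ∈)  → let ν , ν∈ , ν∼μ = complete μ∈ in ν , keep ν∈ , ν∼μ
    }
  }
  where
  open TriangularBasis B
  low? = λ μ → distinct μ ℕ.≤? distinct κ
  below = filter low? basis
  above = filter (¬? ∘ low?) basis
  below-κ : ∀ {μ} → μ ∈ below → Triangular μ κ
  below-κ μ∈ with μ∈basis , le ← ∈-filter⁻ low? {xs = basis} μ∈ =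
    decidable-stable (_ ℕ.≟ 0) λ ne → none (lose μ∈basis (le , ne))
  below-above : ∀ {μ ν} → μ ∈ below → ν ∈ above → Triangular μ ν
  below-above {μ} {ν} μ∈ ν∈ = distinct-<⇒triangular {μ} {ν} (ℕ.≤-<-trans
    (proj₂ (∈-filter⁻ low? {xs = basis} μ∈)) (ℕ.≰⇒> (proj₂ (∈-filter⁻ (¬? ∘ low?) {xs = basis} ν∈))))
  keep : ∀ {μ} → μ ∈ basis → μ ∈ below ++ κ ∷ above
  keep {μ} μ∈ with low? μ
  ... | yes le = ∈-++⁺ˡ (∈-filter⁺ low? μ∈ le)
  ... | no nle = ∈-++⁺ʳ below (there (∈-filter⁺ (¬? ∘ low?) μ∈ nle))

-- Invariance of the coloring counts under isomorphism.

toList-tabulate : ∀ {A : Set} (h : Fin n → A) → toList (Vec.tabulate h) ≡ List.tabulate h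
toList-tabulate {zero}  h = refl
toList-tabulate {suc n} h = cong (h zero ∷_) (toList-tabulate (h ∘ suc))

allFin-↭ : ∀ {m} (π : Permutation m n) → map (π ⟨$⟩ʳ_) (allFin m) ↭ allFin n
allFin-↭ {n} {m} π = ∼bag⇒↭ (unique∧set⇒bag (Unique.map⁺ (Injection.injective (↔⇒↣ π)) (Unique.allFin⁺ m))
  (Unique.allFin⁺ n) (mk⇔ (λ _ → ∈-allFin _)
    (λ _ → subst (_∈ _) (Permutation.inverseʳ π) (∈-map⁺ (π ⟨$⟩ʳ_) (∈-allFin (π ⟨$⟩ˡ _))))))

pullback : ∀ {m} → Permutation m n → Coloring n → Coloring m
pullback π f = Vec.tabulate (λ u → lookup f (π ⟨$⟩ʳ u))

monomial-pullback : ∀ {m} (π : Permutation m n) f → monomial (pullback π f) ↭ monomial f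
monomial-pullback {n} {m} π f = begin
  toList (Vec.tabulate (lookup f ∘ to))  ≡⟨ toList-tabulate (lookup f ∘ to) ⟩
  List.tabulate (lookup f ∘ to)          ≡⟨ List.map-tabulate id (lookup f ∘ to) ⟨
  map (lookup f ∘ to) (allFin m)         ≡⟨ List.map-∘ (allFin m) ⟩
  map (lookup f) (map to (allFin m))     ↭⟨ ↭-map⁺ (lookup f) (allFin-↭ π) ⟩
  map (lookup f) (allFin n)              ≡⟨ List.map-tabulate id (lookup f) ⟩
  List.tabulate (lookup f)               ≡⟨ toList-tabulate (lookup f) ⟨
  toList (Vec.tabulate (lookup f))       ≡⟨ cong toList (Vec.tabulate∘lookup f) ⟩
  toList f                               ∎
  where
  open PermutationReasoning
  open Inverse π using (to)

pullback-inverse : ∀ {m} (π : Permutation m n) f → pullback (↔-sym π) (pullback π f) ≡ f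
pullback-inverse π f = trans
  (Vec.tabulate-cong λ v → trans (Vec.lookup∘tabulate _ (π ⟨$⟩ˡ v)) (cong (lookup f) (Permutation.inverseʳ π)))
  (Vec.tabulate∘lookup f)

pullback-contributes : ∀ {m} {G : Graph m} {H : Graph n} (i : G ≅ H) {μ f} → Proper H f × monomial f ↭ μ →
  Proper G (pullback (_≅_.bijection i) f) × monomial (pullback (_≅_.bijection i) f) ↭ μ
pullback-contributes i {f = f} (p , f↭μ) =
    (λ u v e eq → p (bijection ⟨$⟩ʳ u) (bijection ⟨$⟩ʳ v) (subst T (preserves u v) e)
      (trans (sym (Vec.lookup∘tabulate _ u)) (trans eq (Vec.lookup∘tabulate _ v))))
  , ↭-trans (monomial-pullback bijection f) f↭μ
  where open _≅_ i

-- Pulling colorings back along the isomorphism is bijective, preserves properness and only reorders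
-- the factors of the monomial.
count-≅ : ∀ {m} {G : Graph m} {H : Graph n} → G ≅ H → ∀ μ → count G μ ≡ count H μ
count-≅ {G = G} {H} i μ = trans
  (same-length (properColorings-unique G μ)
    (Unique.map⁺ pull-injective (properColorings-unique H μ)) back forth)
  (List.length-map pull (properColorings H μ))
  where
  open _≅_ i
  pull = pullback bijection
  pull-injective : ∀ {f g} → pull f ≡ pull g → f ≡ g
  pull-injective {f} {g} eq = trans (sym (pullback-inverse bijection f))
    (trans (cong (pullback (↔-sym bijection)) eq) (pullback-inverse bijection g))
  back : ∀ {f} → f ∈ properColorings G μ → f ∈ map pull (properColorings H μ)
  back {f} f∈ = subst (_∈ _) (pullback-inverse (↔-sym bijection) f) (∈-map⁺ pull
    (properColorings-complete H (pullback-contributes (≅-sym i) (properColorings-sound G f∈))))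
  forth : ∀ {f} → f ∈ map pull (properColorings H μ) → f ∈ properColorings G μ
  forth f∈ with g , g∈ , refl ← ∈-map⁻ pull f∈ =
    properColorings-complete G (pullback-contributes i (properColorings-sound H g∈))

-- The modular relation by inclusion-exclusion.

module _ {A : Set} {P Q R S : Pred A 0ℓ}
  (P? : U.Decidable P) (Q? : U.Decidable Q) (R? : U.Decidable R) (S? : U.Decidable S)
  (R≐P∪Q : R U.≐ P U.∪ Q) (S≐P∩Q : S U.≐ P U.∩ Q) where

  inclusion-exclusion : ∀ xs →
    length (filter R? xs) +ℕ length (filter S? xs) ≡ length (filter P? xs) +ℕ length (filter Q? xs)
  inclusion-exclusion [] = refl
  inclusion-exclusion (x ∷ xs) with ih ← inclusion-exclusion xs | P? x | Q? x
  ... | yes p | yes q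
    rewrite List.filter-accept R? {xs = xs} (proj₂ R≐P∪Q (inj₁ p))
          | List.filter-accept S? {xs = xs} (proj₂ S≐P∩Q (p , q)) =
    cong suc (trans (ℕ.+-suc _ _) (trans (cong suc ih) (sym (ℕ.+-suc _ _))))
  ... | yes p | no ¬q
    rewrite List.filter-accept R? {xs = xs} (proj₂ R≐P∪Q (inj₁ p))
          | List.filter-reject S? {xs = xs} (¬q ∘ proj₂ ∘ proj₁ S≐P∩Q) = cong suc ih
  ... | no ¬p | yes q
    rewrite List.filter-accept R? {xs = xs} (proj₂ R≐P∪Q (inj₂ q))
          | List.filter-reject S? {xs = xs} (¬p ∘ proj₁ ∘ proj₁ S≐P∩Q) = trans (cong suc ih) (sym (ℕ.+-suc _ _))
  ... | no ¬p | no ¬q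
    rewrite List.filter-reject R? {xs = xs} ([ ¬p , ¬q ] ∘ proj₁ R≐P∪Q)
          | List.filter-reject S? {xs = xs} (¬p ∘ proj₁ ∘ proj₁ S≐P∩Q) = ih

joins-self : ∀ (x y : Fin n) → joins x y x y ≡ true
joins-self x y with x Fin.≟ x | y Fin.≟ y
... | yes _   | yes _  = refl
... | yes _   | no y≢y = contradiction refl y≢y
... | no x≢x  | _      = contradiction refl x≢x

joins⇒≡ : ∀ (x y u v : Fin n) → T (joins x y u v) → (u ≡ x × v ≡ y) ⊎ (v ≡ x × u ≡ y)
joins⇒≡ x y u v t with u Fin.≟ x | v Fin.≟ y | v Fin.≟ x | u Fin.≟ y
... | yes a | yes b | _     | _     = inj₁ (a , b)
... | yes _ | no _  | yes c | yes d = inj₂ (c , d)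
... | no _  | _     | yes c | yes d = inj₂ (c , d)

proper-∪ᵉ : ∀ (G : Graph n) {x y} (x≢y : x ≢ y) f →
            (Proper (G ∪ᵉ ((x , y) , x≢y)) f → Proper G f × lookup f x ≢ lookup f y)
            × (Proper G f × lookup f x ≢ lookup f y → Proper (G ∪ᵉ ((x , y) , x≢y)) f)
proper-∪ᵉ G {x} {y} x≢y f =
    (λ p → (λ u v e → p u v (Equivalence.from Bool.T-∨ (inj₁ e)))
         , p x y (Equivalence.from (Bool.T-∨ {adj G x y}) (inj₂ (subst T (sym (joins-self x y)) _))))
  , (λ (p , fx≢fy) u v e → [ p u v , (λ j → [ (λ { (refl , refl) → fx≢fy }) , (λ { (refl , refl) → fx≢fy ∘ sym }) ] (joins⇒≡ x y u v j)) ]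
       (Equivalence.to Bool.T-∨ e))

-- The edge from `x` to `z` forces different colors there, so a proper coloring of `G` separates `y`
-- from `x` or from `z`. The proper colorings of `G` are thus the union of those of `G ∪ᵉ e₁` and
-- `G ∪ᵉ e₂`, with intersection those of `G ∪ᵉ e₁ ∪ᵉ e₂`.
count-modular : ∀ (G : Graph n) {x y z} (x≢y : x ≢ y) (y≢z : y ≢ z) → adj G x z ≡ true → ∀ μ →
  let e₁ = (x , y) , x≢y
      e₂ = (y , z) , y≢z
  in count G μ +ℕ count (G ∪ᵉ e₁ ∪ᵉ e₂) μ ≡ count (G ∪ᵉ e₁) μ +ℕ count (G ∪ᵉ e₂) μ
count-modular {n} G {x} {y} {z} x≢y y≢z xz μ = inclusion-exclusion
  (contributes? G₁ μ) (contributes? G₂ μ) (contributes? G μ) (contributes? (G₁ ∪ᵉ e₂) μ)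
  ( (λ {f} (p , q) → [ (λ fx≢fy → inj₁ (proj₂ (proper-∪ᵉ G x≢y f) (p , fx≢fy) , q))
                     , (λ fy≢fz → inj₂ (proj₂ (proper-∪ᵉ G y≢z f) (p , fy≢fz) , q)) ] (separated f p))
  , λ {f} → [ (λ (p , q) → proj₁ (proj₁ (proper-∪ᵉ G x≢y f) p) , q) , (λ (p , q) → proj₁ (proj₁ (proper-∪ᵉ G y≢z f) p) , q) ])
  ( (λ {f} (p , q) → let p₁ , fy≢fz = proj₁ (proper-∪ᵉ G₁ y≢z f) p in
      (p₁ , q) , (proj₂ (proper-∪ᵉ G y≢z f) (proj₁ (proj₁ (proper-∪ᵉ G x≢y f) p₁) , fy≢fz) , q))
  , (λ {f} ((p₁ , q) , (p₂ , _)) → proj₂ (proper-∪ᵉ G₁ y≢z f) (p₁ , proj₂ (proj₁ (proper-∪ᵉ G y≢z f) p₂)) , q))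
  -- All four counts filter this same list of candidates.
  (vectors (deduplicate ℕ._≟_ μ) n)
  where
  e₁ e₂ : Edge
  e₁ = (x , y) , x≢y
  e₂ = (y , z) , y≢z
  G₁ = G ∪ᵉ e₁
  G₂ = G ∪ᵉ e₂
  separated : ∀ f → Proper G f → lookup f x ≢ lookup f y ⊎ lookup f y ≢ lookup f z
  separated f p with lookup f x ℕ.≟ lookup f y
  ... | no fx≢fy  = inj₁ fx≢fy
  ... | yes fx≡fy = inj₂ λ fy≡fz → p x z (subst T (sym xz) _) (trans fx≡fy fy≡fz)

-- The number of nonedges as an induction measure.

pairs : ∀ n → List (Fin n × Fin n)
pairs n = cartesianProduct (allFin n) (allFin n)

nonEdge? : (G : Graph n) → U.Decidable (λ ((u , v) : Fin n × Fin n) → adj G u v ≡ false)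
nonEdge? G (u , v) = adj G u v Bool.≟ false

-- Ordered pairs are counted, the diagonal included; the induction only uses that the number drops.
nonEdges : Graph n → ℕ
nonEdges {n} G = length (filter (nonEdge? G) (pairs n))

module _ {A : Set} {P Q : Pred A 0ℓ} (P? : U.Decidable P) (Q? : U.Decidable Q) (P⊆Q : P U.⊆ Q) where

  length-filter-mono-≤ : ∀ xs → length (filter P? xs) ≤ length (filter Q? xs)
  length-filter-mono-≤ [] = z≤n
  length-filter-mono-≤ (x ∷ xs) with P? x | Q? x
  ... | yes _ | yes _ = s≤s (length-filter-mono-≤ xs)
  ... | yes p | no ¬q = contradiction (P⊆Q p) ¬q
  ... | no _  | yes _ = ℕ.m≤n⇒m≤1+n (length-filter-mono-≤ xs)
  ... | no _  | no _  = length-filter-mono-≤ xs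

  length-filter-mono-< : ∀ {xs x} → x ∈ xs → ¬ P x → Q x → length (filter P? xs) < length (filter Q? xs)
  length-filter-mono-< {x ∷ xs} (here refl) ¬p q
    rewrite List.filter-reject P? {xs = xs} ¬p | List.filter-accept Q? {xs = xs} q = s≤s (length-filter-mono-≤ xs)
  length-filter-mono-< {x ∷ xs} (there x∈) ¬p q with P? x | Q? x
  ... | yes _  | yes _ = s≤s (length-filter-mono-< x∈ ¬p q)
  ... | yes p′ | no ¬q = contradiction (P⊆Q p′) ¬q
  ... | no _   | yes _ = ℕ.m≤n⇒m≤1+n (length-filter-mono-< x∈ ¬p q)
  ... | no _   | no _  = length-filter-mono-< x∈ ¬p q

module _ (G : Graph n) {x y : Fin n} (x≢y : x ≢ y) where

  nonEdges-∪ᵉ-≤ : nonEdges (G ∪ᵉ ((x , y) , x≢y)) ≤ nonEdges G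
  nonEdges-∪ᵉ-≤ = length-filter-mono-≤ (nonEdge? (G ∪ᵉ ((x , y) , x≢y))) (nonEdge? G)
    (λ {(u , v)} → Bool.∨-conicalˡ (adj G u v) _) (pairs n)

  nonEdges-∪ᵉ-< : adj G x y ≡ false → nonEdges (G ∪ᵉ ((x , y) , x≢y)) < nonEdges G
  nonEdges-∪ᵉ-< xy = length-filter-mono-< (nonEdge? (G ∪ᵉ ((x , y) , x≢y))) (nonEdge? G)
    (λ {(u , v)} → Bool.∨-conicalˡ (adj G u v) _)
    {xs = pairs n} (∈-cartesianProduct⁺ (∈-allFin x) (∈-allFin y))
    (λ eq → contradiction (trans (sym (joins-self x y)) (Bool.∨-conicalʳ (adj G x y) _ eq)) λ ()) xy

-- Spans in a module.

module _ {r ℓr a ℓa} {R : Ring r ℓr} (M : LeftModule R a ℓa) where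

  open LeftModule M
  open Ring R using (-_; 1#; 0#; -‿inverseʳ) renaming (_+_ to _+ᴿ_)
  open AbelianGroupProperties +ᴹ-abelianGroup using (inverseʳ-unique)
  open CommutativeSemigroupProperties (CommutativeMonoid.commutativeSemigroup +ᴹ-commutativeMonoid)
    using (interchange)
  open SetoidReasoning ≈ᴹ-setoid

  -1*ₗ : ∀ x → (- 1#) *ₗ x ≈ᴹ -ᴹ x
  -1*ₗ x = inverseʳ-unique x ((- 1#) *ₗ x) (begin
    x +ᴹ (- 1#) *ₗ x           ≈⟨ +ᴹ-congʳ (*ₗ-identityˡ x) ⟨
    1# *ₗ x +ᴹ (- 1#) *ₗ x     ≈⟨ *ₗ-distribʳ x 1# (- 1#) ⟨
    (1# +ᴿ (- 1#)) *ₗ x        ≈⟨ *ₗ-congʳ (-‿inverseʳ 1#) ⟩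
    0# *ₗ x                    ≈⟨ *ₗ-zeroˡ x ⟩
    0ᴹ                         ∎)

  module _ {p} {P : Pred Carrierᴹ p} where

    span-neg : ∀ {x} → Span M P x → Span M P (-ᴹ x)
    span-neg {x} s = resp≈ (-1*ₗ x) (*∈ (- 1#) s)

    -- Used to solve a relation for one of its terms.
    span-cancelʳ : ∀ {x y} → Span M P (x +ᴹ y) → Span M P y → Span M P x
    span-cancelʳ {x} {y} s t = resp≈ (begin
      (x +ᴹ y) +ᴹ -ᴹ y   ≈⟨ +ᴹ-assoc x y (-ᴹ y) ⟩
      x +ᴹ (y +ᴹ -ᴹ y)   ≈⟨ +ᴹ-congˡ (-ᴹ‿inverseʳ y) ⟩
      x +ᴹ 0ᴹ            ≈⟨ +ᴹ-identityʳ x ⟩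
      x                  ∎) (+∈ s (span-neg t))

  module _ {p q} {P : Pred Carrierᴹ p} {Q : Pred Carrierᴹ q} where

    span-mono : P ⊆ Q → Span M P ⊆ Span M Q
    span-mono P⊆Q (gen x∈P)    = gen (P⊆Q x∈P)
    span-mono P⊆Q 0∈           = 0∈
    span-mono P⊆Q (+∈ s t)     = +∈ (span-mono P⊆Q s) (span-mono P⊆Q t)
    span-mono P⊆Q (*∈ k s)     = *∈ k (span-mono P⊆Q s)
    span-mono P⊆Q (resp≈ eq s) = resp≈ eq (span-mono P⊆Q s)

    -- The linear algebra behind an elimination step: the contributions of one generator `v` are
    -- collected into a single multiple of it.
    span-split : ∀ {v} → (∀ {x} → P x → Q x ⊎ x ≡ v) → ∀ {x} → Span M P x →
                 ∃ λ k → ∃ λ y → Span M Q y × x ≈ᴹ k *ₗ v +ᴹ y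
    span-split {v} split {x} (gen x∈P) with split x∈P
    ... | inj₁ x∈Q  = 0# , x , gen x∈Q , ≈ᴹ-sym (≈ᴹ-trans (+ᴹ-congʳ (*ₗ-zeroˡ v)) (+ᴹ-identityˡ x))
    ... | inj₂ refl = 1# , 0ᴹ , 0∈ , ≈ᴹ-sym (≈ᴹ-trans (+ᴹ-identityʳ _) (*ₗ-identityˡ v))
    span-split {v} split 0∈ = 0# , 0ᴹ , 0∈ , ≈ᴹ-sym (≈ᴹ-trans (+ᴹ-identityʳ _) (*ₗ-zeroˡ v))
    span-split {v} split (+∈ s t) =
      let k , y , y∈ , x≈ = span-split split s
          l , z , z∈ , w≈ = span-split split t
      in k +ᴿ l , y +ᴹ z , +∈ y∈ z∈
       , ≈ᴹ-trans (+ᴹ-cong x≈ w≈) (≈ᴹ-trans (interchange _ _ _ _) (+ᴹ-congʳ (≈ᴹ-sym (*ₗ-distribʳ v k l))))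
    span-split {v} split (*∈ k s) =
      let l , y , y∈ , x≈ = span-split split s
      in _ , k *ₗ y , *∈ k y∈
       , ≈ᴹ-trans (*ₗ-congˡ x≈) (≈ᴹ-trans (*ₗ-distribˡ k _ y) (+ᴹ-congʳ (≈ᴹ-sym (*ₗ-assoc k l v))))
    span-split split (resp≈ eq s) =
      let k , y , y∈ , x≈ = span-split split s in k , y , y∈ , ≈ᴹ-trans (≈ᴹ-sym eq) x≈

-- The relations lie in the kernel.

module _ {c ℓ₁ ℓ₂} (K : HeytingField c ℓ₁ ℓ₂) where

  open ChromaticSymmetricFunctions K
  open CommutativeRing (commutativeRing K) renaming (refl to ≈-reflexive; sym to ≈-sym; trans to ≈-trans)
  open RawMonoidDefinitions +-rawMonoid using () renaming (_×_ to _·_)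
  open MonoidMultiplication +-monoid using (×-homo-+)
  open RingProperties ring using (-0#≈0#; -‿+-comm; -1*x≈-x)
  open CommutativeSemigroupProperties (CommutativeMonoid.commutativeSemigroup +-commutativeMonoid) using (x∙yz≈y∙xz)
  open 𝐅 using (Combination)
  open 𝐅.Extension Sym (λ G → chromatic (proj₂ G)) chromatic-cong using (extend-++; extend-⊙; extend-cong)
  open SetoidReasoning setoid
  open SymmetricFunction using (coeff)

  Ψ-coeff : Combination → Monomial → Carrier
  Ψ-coeff x = coeff (LinearMap.to Ψ x)

  number : ∀ {n} → Graph n → Monomial → Carrier
  number G μ = count G μ · 1#

  -- One `μ` at a time: relations vanish at every monomial, but the graphs left over in `eliminate`
  -- are only known to vanish at the one being eliminated.
  span-vanishes : ∀ {p} {P : Pred Combination p} μ → (∀ {x} → P x → Ψ-coeff x μ ≈ 0#) →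
                  ∀ {x} → Span 𝐆 P x → Ψ-coeff x μ ≈ 0#
  span-vanishes μ P≈0 (gen x∈P)            = P≈0 x∈P
  span-vanishes μ P≈0 0∈                   = ≈-refl
  span-vanishes μ P≈0 (+∈ {x} {y} s t)     = begin
    Ψ-coeff (x ++ y) μ         ≈⟨ extend-++ x y μ ⟩
    Ψ-coeff x μ + Ψ-coeff y μ  ≈⟨ +-cong (span-vanishes μ P≈0 s) (span-vanishes μ P≈0 t) ⟩
    0# + 0#                    ≈⟨ +-identityˡ 0# ⟩
    0#                         ∎
  span-vanishes μ P≈0 (*∈ k {x} s)         =
    ≈-trans (extend-⊙ k x μ) (≈-trans (*-congˡ (span-vanishes μ P≈0 s)) (zeroʳ k))
  span-vanishes μ P≈0 (resp≈ {x} {y} eq s) =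
    ≈-trans (≈-sym (extend-cong {x} {y} eq μ)) (span-vanishes μ P≈0 s)

  Relations : Pred Combination c
  Relations = ModularRelation ∪ IsomorphismRelation

  relations-vanish : ∀ μ {x} → Relations x → Ψ-coeff x μ ≈ 0#
  relations-vanish μ (inj₂ (isomorphism G H G≅H)) = begin
    1# * number G μ + (- 1# * number H μ + 0#)  ≈⟨ +-cong (*-identityˡ _) (≈-trans (+-identityʳ _) (-1*x≈-x _)) ⟩
    number G μ + - number H μ                   ≈⟨ +-congʳ (reflexive (cong (_· 1#) (count-≅ G≅H μ))) ⟩
    number H μ + - number H μ                   ≈⟨ -‿inverseʳ _ ⟩
    0#                                          ∎
  relations-vanish μ (inj₁ (modular G {x} {y} {z} x≢y y≢z _ xz _ _)) = begin
    1# * a + (- 1# * b₁ + (- 1# * b₂ + (1# * d + 0#)))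
      ≈⟨ +-cong (*-identityˡ a) (+-cong (-1*x≈-x b₁) (+-cong (-1*x≈-x b₂) (≈-trans (+-identityʳ _) (*-identityˡ d)))) ⟩
    a + (- b₁ + (- b₂ + d))   ≈⟨ +-congˡ (+-congˡ (+-comm (- b₂) d)) ⟩
    a + (- b₁ + (d + - b₂))   ≈⟨ +-congˡ (x∙yz≈y∙xz (- b₁) d (- b₂)) ⟩
    a + (d + (- b₁ + - b₂))   ≈⟨ +-assoc a d _ ⟨
    (a + d) + (- b₁ + - b₂)   ≈⟨ +-cong a+d≈b₁+b₂ (-‿+-comm b₁ b₂) ⟩
    (b₁ + b₂) + - (b₁ + b₂)   ≈⟨ -‿inverseʳ _ ⟩
    0#                        ∎
    where
    e₁ e₂ : Edge
    e₁ = (x , y) , x≢y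
    e₂ = (y , z) , y≢z
    a b₁ b₂ d : Carrier
    a  = number G μ
    b₁ = number (G ∪ᵉ e₁) μ
    b₂ = number (G ∪ᵉ e₂) μ
    d  = number (G ∪ᵉ e₁ ∪ᵉ e₂) μ
    a+d≈b₁+b₂ : a + d ≈ b₁ + b₂
    a+d≈b₁+b₂ = begin
      a + d                                                ≈⟨ ×-homo-+ 1# (count G μ) _ ⟨
      (count G μ +ℕ count (G ∪ᵉ e₁ ∪ᵉ e₂) μ) · 1#         ≈⟨ reflexive (cong (_· 1#) (count-modular G x≢y y≢z xz μ)) ⟩
      (count (G ∪ᵉ e₁) μ +ℕ count (G ∪ᵉ e₂) μ) · 1#       ≈⟨ ×-homo-+ 1# (count (G ∪ᵉ e₁) μ) _ ⟩
      b₁ + b₂                                              ∎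

  -- Reduction to multipartite graphs modulo the relations.

  DegreeAtMost : ℕ → Pred Combination c
  DegreeAtMost d = All (λ (_ , n , _) → n ≤ d)

  Multipartite : List Monomial → Pred Combination c
  Multipartite L x = ∃ λ ν → ν ∈ L × x ≡ ⟨ multipartite ν ⟩

  module _ (d : ℕ) where

    open TriangularBasis (triangularBasis (monomials d))

    -- Congruence modulo the relations to a combination of basis graphs, phrased without a quotient
    -- module by adding the relations to the generators.
    Reduced : Pred Combination (c ⊔ˡ ℓ₁)
    Reduced = Span 𝐆 (Relations ∪ Multipartite basis)

    isomorphic-reduced : ∀ {m n} {G : Graph m} {H : Graph n} → G ≅ H → Reduced ⟨ H ⟩ → Reduced ⟨ G ⟩
    isomorphic-reduced {G = G} {H} G≅H H∈ =
      span-cancelʳ 𝐆 (gen (inj₁ (inj₂ (isomorphism G H G≅H)))) (span-neg 𝐆 H∈)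

    graph-reduced : ∀ {n} → n ≤ d → (G : Graph n) → Acc _<_ (nonEdges G) → Reduced ⟨ G ⟩
    graph-reduced {n} n≤d G (acc rec)
      with Fin.any? (λ x → Fin.any? λ y → Fin.any? λ z →
             adj G x z Bool.≟ true ×-dec adj G x y Bool.≟ false ×-dec adj G y z Bool.≟ false)
    ... | yes (x , y , z , xz , xy , yz) =
      -- The terms of the modular relation are removed from the right until only `⟨ G ⟩` is left.
      span-cancelʳ 𝐆 (span-cancelʳ 𝐆 (span-cancelʳ 𝐆
        (gen (inj₁ (inj₁ (modular G x≢y y≢z x≢z xz xy yz))))
        -- The edge `e₁` already gives the strict decrease; `e₂` only must not undo it.
        (graph-reduced n≤d (G ∪ᵉ e₁ ∪ᵉ e₂) (rec (ℕ.≤-<-trans (nonEdges-∪ᵉ-≤ (G ∪ᵉ e₁) y≢z) (nonEdges-∪ᵉ-< G x≢y xy)))))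
        (span-neg 𝐆 (graph-reduced n≤d (G ∪ᵉ e₂) (rec (nonEdges-∪ᵉ-< G y≢z yz)))))
        (span-neg 𝐆 (graph-reduced n≤d (G ∪ᵉ e₁) (rec (nonEdges-∪ᵉ-< G x≢y xy))))
      where
      x≢y : x ≢ y
      x≢y refl = contradiction (trans (sym xz) yz) λ ()
      y≢z : y ≢ z
      y≢z refl = contradiction (trans (sym xz) xy) λ ()
      x≢z : x ≢ z
      x≢z refl = contradiction (trans (sym xz) (loopless G x)) λ ()
      e₁ e₂ : Edge
      e₁ = (x , y) , x≢y
      e₂ = (y , z) , y≢z
    -- Two isomorphisms are chained: from `G` to M(μ) for its own classes, then to the
    -- representative `ν` in the basis.
    ... | no none with ν , ν∈ , ν∼ ← complete (classes-∈-monomials G n≤d) =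
      isomorphic-reduced (transitive⇒multipartite G transitive)
        (isomorphic-reduced (∼⇒≅ ν∼) (gen (inj₂ (ν , ν∈ , refl))))
      where
      transitive : NonadjacencyTransitive G
      transitive x y z xy yz with adj G x z in xz
      ... | false = refl
      ... | true  = contradiction (x , y , z , xz , xy , yz) none

    reduced : ∀ x → DegreeAtMost d x → Reduced x
    reduced []                _           = 0∈
    -- Scaling `⟨ G ⟩` by `k` produces the coefficient `k * 1#` in place of `k`.
    reduced ((k , _ , G) ∷ x) (n≤d ∷ x≤d) = resp≈ (λ t → +-congʳ (simplify t))
      (+∈ (*∈ k (graph-reduced n≤d G (<-wellFounded _))) (reduced x x≤d))
      where
      simplify : ∀ t → (if does ((_ , G) ≐? t) then k * 1# else 0#) ≈ (if does ((_ , G) ≐? t) then k else 0#)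
      simplify t with does ((_ , G) ≐? t)
      ... | true  = *-identityʳ k
      ... | false = ≈-refl

  -- Terms whose coefficients cancel count as well: any bound will do to select a finite basis.
  degree : Combination → ℕ
  degree []                = 0
  degree ((_ , n , _) ∷ x) = n ⊔ degree x

  degree-bounds : ∀ x → DegreeAtMost (degree x) x
  degree-bounds []                = []
  degree-bounds ((_ , n , _) ∷ x) =
    ℕ.m≤m⊔n n (degree x) ∷ All.map (λ le → ℕ.≤-trans le (ℕ.m≤n⊔m n (degree x))) (degree-bounds x)

  -- Solving the triangular system in characteristic zero.

  module _ (characteristicZero : CharacteristicZero K) where

    inverse : ∀ {m} → m ≢ 0 → ∃ λ k → k * (m · 1#) ≈ 1#
    inverse {zero}  m≢0 = contradiction refl m≢0
    inverse {suc m} m≢0 =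
      let k , k*[m-0]≈1 , _ = HeytingField.#⇒invertible K (characteristicZero m)
      -- Apartness from `0#` makes the difference with `0#` invertible; the congruence removes that
      -- subtraction.
      in k , ≈-trans (*-congˡ (≈-sym (≈-trans (+-congˡ -0#≈0#) (+-identityʳ _)))) k*[m-0]≈1

    -- At the first monomial `μ`, the relations and all later graphs have coefficient 0. The
    -- coefficient of `x` there is thus `k` times an invertible number, so `k` is 0 and M(μ) drops
    -- out.
    eliminate : ∀ {L} → AllPairs Triangular L → ∀ {x} → Span 𝐆 (Relations ∪ Multipartite L) x →
                (∀ μ → Ψ-coeff x μ ≈ 0#) → Span 𝐆 Relations x
    eliminate []                          s _ = span-mono 𝐆 (λ { (inj₁ rel) → rel ; (inj₂ ()) }) s
    eliminate {μ ∷ L} (triangular ∷ rest) {x} s Ψx≈0 =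
      resp≈ (λ t → ≈-sym (x≈y t)) (eliminate rest y∈ λ ν → ≈-trans (≈-sym (extend-cong {x} {y} x≈y ν)) (Ψx≈0 ν))
      where
      splitting = span-split 𝐆 {Q = Relations ∪ Multipartite L} {v = ⟨ multipartite μ ⟩}
        (λ { (inj₁ rel) → inj₁ (inj₁ rel)
           ; (inj₂ (_ , here refl , x≡)) → inj₂ x≡
           ; (inj₂ (ν , there ν∈ , x≡)) → inj₁ (inj₂ (ν , ν∈ , x≡)) }) s
      k = proj₁ splitting
      y = proj₁ (proj₂ splitting)
      y∈ = proj₁ (proj₂ (proj₂ splitting))
      x≈kμ+y = proj₂ (proj₂ (proj₂ splitting))
      y≈0 : Ψ-coeff y μ ≈ 0#
      y≈0 = span-vanishes μ (λ
        { (inj₁ rel) → relations-vanish μ rel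
        ; (inj₂ (ν , ν∈ , refl)) → begin
            1# * number (multipartite ν) μ + 0#  ≈⟨ +-identityʳ _ ⟩
            1# * number (multipartite ν) μ       ≈⟨ *-identityˡ _ ⟩
            number (multipartite ν) μ            ≡⟨ cong (_· 1#) (All.lookup triangular ν∈) ⟩
            0#                                   ∎
        }) y∈
      m⁻¹ = inverse (count-diagonal μ)
      m = number (multipartite μ) μ
      k≈0 : k ≈ 0#
      k≈0 = begin
        k                               ≈⟨ *-identityʳ k ⟨
        k * 1#                          ≈⟨ *-congˡ (proj₂ m⁻¹) ⟨
        k * (proj₁ m⁻¹ * m)             ≈⟨ *-congˡ (*-comm _ m) ⟩
        k * (m * proj₁ m⁻¹)             ≈⟨ *-assoc k m _ ⟨
        (k * m) * proj₁ m⁻¹             ≈⟨ *-congʳ km≈0 ⟩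
        0# * proj₁ m⁻¹                  ≈⟨ zeroˡ _ ⟩
        0#                              ∎
        where
        km≈0 : k * m ≈ 0#
        km≈0 = begin
          k * m                                       ≈⟨ *-congʳ (*-identityʳ k) ⟨
          (k * 1#) * m                                ≈⟨ +-identityʳ _ ⟨
          (k * 1#) * m + 0#                           ≈⟨ +-congˡ y≈0 ⟨
          (k * 1#) * m + Ψ-coeff y μ                  ≈⟨ extend-cong {x} {(k * 1# , _ , multipartite μ) ∷ y} x≈kμ+y μ ⟨
          Ψ-coeff x μ                                 ≈⟨ Ψx≈0 μ ⟩
          0#                                          ∎
      x≈y : ∀ t → 𝐅.coeff x t ≈ 𝐅.coeff y t
      x≈y t = ≈-trans (x≈kμ+y t) (≈-trans (+-congʳ vanishing) (+-identityˡ _))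
        where
        vanishing : (if does ((_ , multipartite μ) ≐? t) then k * 1# else 0#) ≈ 0#
        vanishing with does ((_ , multipartite μ) ≐? t)
        ... | true  = ≈-trans (*-identityʳ k) k≈0
        ... | false = ≈-refl

    -- The vanishing clause ensures that the later graphs do not disturb the value fixed at the
    -- first monomial. In `surjective` it also gives the zeros above degree `d`.
    interpolate : ∀ {L} → AllPairs Triangular L → (p : Monomial → Carrier) →
                  ∃ λ x → (∀ {μ} → μ ∈ L → Ψ-coeff x μ ≈ p μ)
                        × (∀ {μ} → All (Triangular μ) L → Ψ-coeff x μ ≈ 0#)
    interpolate []                       p = [] , (λ ()) , λ _ → ≈-refl
    interpolate {ν ∷ L} (triangular ∷ rest) p = (k , _ , multipartite ν) ∷ x , agree , vanish
      where
      m = number (multipartite ν)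
      m⁻¹ = inverse (count-diagonal ν)
      k = p ν * proj₁ m⁻¹
      -- M(ν) also contributes at the later monomials, so its share is subtracted from their
      -- targets.
      rec = interpolate rest (λ μ → p μ + - (k * m μ))
      x = proj₁ rec
      agree : ∀ {μ} → μ ∈ ν ∷ L → k * m μ + Ψ-coeff x μ ≈ p μ
      agree (here refl) = begin
        k * m ν + Ψ-coeff x ν           ≈⟨ +-congˡ (proj₂ (proj₂ rec) triangular) ⟩
        k * m ν + 0#                    ≈⟨ +-identityʳ _ ⟩
        (p ν * proj₁ m⁻¹) * m ν         ≈⟨ *-assoc (p ν) _ _ ⟩
        p ν * (proj₁ m⁻¹ * m ν)         ≈⟨ *-congˡ (proj₂ m⁻¹) ⟩
        p ν * 1#                        ≈⟨ *-identityʳ _ ⟩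
        p ν                             ∎
      agree {μ} (there μ∈) = begin
        k * m μ + Ψ-coeff x μ           ≈⟨ +-congˡ (proj₁ (proj₂ rec) μ∈) ⟩
        k * m μ + (p μ + - (k * m μ))   ≈⟨ x∙yz≈y∙xz _ _ _ ⟩
        p μ + (k * m μ + - (k * m μ))   ≈⟨ +-congˡ (-‿inverseʳ _) ⟩
        p μ + 0#                        ≈⟨ +-identityʳ _ ⟩
        p μ                             ∎
      vanish : ∀ {μ} → All (Triangular μ) (ν ∷ L) → k * m μ + Ψ-coeff x μ ≈ 0#
      vanish {μ} (ν≡0 ∷ L≡0) = begin
        k * m μ + Ψ-coeff x μ   ≈⟨ +-cong (*-congˡ (reflexive (cong (_· 1#) ν≡0))) (proj₂ (proj₂ rec) L≡0) ⟩
        k * 0# + 0#             ≈⟨ +-identityʳ _ ⟩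
        k * 0#                  ≈⟨ zeroʳ k ⟩
        0#                      ∎

    coeff-∼ : ∀ p {μ ν} → μ ∼ ν → coeff p μ ≈ coeff p ν
    coeff-∼ p (σ , μ↭) = ≈-trans (SymmetricFunction.coeff-↭ p μ↭) (SymmetricFunction.symmetric p σ _)

    surjective : StrictlySurjective (LeftModule._≈ᴹ_ Sym) (LinearMap.to Ψ)
    surjective p = x , Ψx≈p
      where
      d = proj₁ (SymmetricFunction.bounded p)
      open TriangularBasis (triangularBasis (monomials d))
      rec = interpolate triangular (coeff p)
      x = proj₁ rec
      Ψx≈p : ∀ μ → Ψ-coeff x μ ≈ coeff p μ
      Ψx≈p μ with length μ ℕ.≤? d
      -- Above degree `d` both sides are 0, as every basis graph has at most `d` vertices.
      ... | no μ≰d = ≈-trans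
        (proj₂ (proj₂ rec) (All.tabulate λ {ν} ν∈ → count-degree (multipartite ν) μ
          (ℕ.≤-<-trans (monomials-length (sound ν∈)) (ℕ.≰⇒> μ≰d))))
        (≈-sym (proj₂ (SymmetricFunction.bounded p) μ (ℕ.≰⇒> μ≰d)))
      -- Both sides are constant on the classes of `∼`, so agreement at the representative `ν`
      -- suffices; `κ` links `μ` to the finite list.
      ... | yes μ≤d with ν , ν∈ , ν∼ ← complete (classes-∈-monomials (multipartite μ) μ≤d) = begin
        Ψ-coeff x μ   ≈⟨ coeff-∼ (LinearMap.to Ψ x) (classes-∼ μ) ⟨
        Ψ-coeff x κ   ≈⟨ coeff-∼ (LinearMap.to Ψ x) ν∼ ⟨
        Ψ-coeff x ν   ≈⟨ proj₁ (proj₂ rec) ν∈ ⟩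
        coeff p ν     ≈⟨ coeff-∼ p ν∼ ⟩
        coeff p κ     ≈⟨ coeff-∼ p (classes-∼ μ) ⟩
        coeff p μ     ∎
        where κ = toList (classes (multipartite μ))

theorem2 : ∀ {c ℓ₁ ℓ₂} (K : HeytingField c ℓ₁ ℓ₂) → CharacteristicZero K →
    let open ChromaticSymmetricFunctions K in
    (Kernel Ψ ≐ Span 𝐆 (ModularRelation ∪ IsomorphismRelation))
    × StrictlySurjective (LeftModule._≈ᴹ_ Sym) (LinearMap.to Ψ)
theorem2 K characteristicZero =
    -- Each kernel element is treated within the finite basis selected by its own degree.
    ( (λ {x} Ψx≈0 → eliminate K characteristicZero (TriangularBasis.triangular (triangularBasis (monomials (degree K x))))
        (reduced K (degree K x) x (degree-bounds K x)) Ψx≈0)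
    , (λ s μ → span-vanishes K μ (relations-vanish K μ) s))
  , surjective K characteristicZero
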